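{- Let $m,n$ be positive integers with $m\equiv 1\pmod 4$ or $m\equiv 4\pmod 8$. Suppose there is an odd prime divisor $p$ of $m$ such that the Legendre symbol $\left(\frac{4n+5}p\right)=-1$. Then $$t(1,1,8,m;n)=\frac 12N(1,1,8,m;8n+10+m).$$
   Context: For positive integers $a_1,\dots,a_k$ and a nonnegative integer $n$, $N(a_1,\dots,a_k;n)$ is the number of $(x_1,\dots,x_k)\in\mathbb Z^k$ with $n=a_1x_1^2+\cdots+a_kx_k^2$, and $t(a_1,\dots,a_k;n)$ is the number of $(x_1,\dots,x_k)\in\mathbb Z^k$ with $n=a_1\frac{x_1(x_1-1)}2+\cdots+a_k\frac{x_k(x_k-1)}2$. -}

module Defs where

open import Data.Nat as ℕ using (ℕ; zero; suc; _%_; _/_)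
open import Data.Integer as ℤ using (ℤ; +_; -[1+_]; ∣_∣)
open import Data.List using (List; []; _∷_; map; concatMap; filter; length; zipWith; upTo)
open import Data.Nat.ListAction using (sum)
open import Relation.Nullary.Decidable using (Dec; yes; no; ⌊_⌋)
open import Data.Bool using (Bool; true; false; if_then_else_)
open import Data.List.Relation.Unary.Any using (any?)
open import Relation.Binary.PropositionalEquality using (_≡_)

intRange : ℕ → List ℤ
intRange B = map (λ i → + i) (upTo (suc B)) Data.List.++ map (λ i → -[1+ i ]) (upTo B)

box : ℕ → ℕ → List (List ℤ)
box zero    B = [] ∷ []
box (suc k) B = concatMap (λ x → map (x ∷_) (box k B)) (intRange B)

-- x(x-1)/2 for an integer x (note x(x-1) ≥ 0 always, so this is exact)
tri : ℤ → ℕ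
tri x = ∣ x ℤ.* (x ℤ.- + 1) ∣ / 2

qform : List ℕ → List ℤ → ℤ
qform as xs = sum′ (zipWith (λ a x → + a ℤ.* (x ℤ.* x)) as xs)
  where
  sum′ : List ℤ → ℤ
  sum′ [] = + 0
  sum′ (y ∷ ys) = y ℤ.+ sum′ ys

tform : List ℕ → List ℤ → ℕ
tform as xs = sum (zipWith (λ a x → a ℕ.* tri x) as xs)

-- N(a_1,...,a_k; n): number of x ∈ ℤ^k with n = Σ a_i x_i^2.
-- For positive a_i every solution has |x_i| ≤ n, so the box [-n,n]^k contains all solutions.
N : List ℕ → ℕ → ℕ
N as n = length (filter (λ xs → qform as xs ℤ.≟ + n) (box (length as) n))

-- t(a_1,...,a_k; n): number of x ∈ ℤ^k with n = Σ a_i x_i(x_i-1)/2.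
-- For positive a_i every solution has |x_i| ≤ n+1, so the box [-(n+1),n+1]^k contains all solutions.
t : List ℕ → ℕ → ℕ
t as n = length (filter (λ xs → tform as xs ℕ.≟ n) (box (length as) (suc n)))

legendre : ℤ → ℕ → ℤ
legendre a zero = + 0
legendre a p@(suc _) with (a ℤ.%ℕ p) ℕ.≟ 0
... | yes _ = + 0
... | no _ with any? (λ x → ((x ℕ.* x) ℕ.% p) ℕ.≟ (a ℤ.%ℕ p)) (upTo p)
...   | yes _ = + 1
...   | no _ = -[1+ 0 ]

{-# OPTIONS --safe #-}

-- Put k = 8n + 10 + m.  Substituting X = 2x − 1, t(1,1,8,m;n) counts the representations
-- k = X² + Y² + 8Z² + mW² with all four variables odd.  Congruences modulo 8 force X, Y, W
-- to be odd in every representation counted by N(1,1,8,m;k), so it suffices that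
-- the sum of (−1)^Z over all representations vanishes.  Fix W = 2l + 1 and write
-- k − mW² = 2q, so that q ≡ 4n + 5 (mod p) is not a square.  Rotating X, Y by 45° turns
-- the sum over the representations with this W into twice
--   P(q) = Σ (−1)^c over x² + 4b² + 4c² = q with x odd,
-- and Jacobi's derivative formula θ₁′ = θ₂θ₃θ₄ says P(q) = J(q), where
--   J(q) = Σ χ₋₄(u) u over odd u with u² = q,
-- which is an empty sum here.
--
-- To prove P = J, compare coefficients in θ₁′ · D(θ₂θ₃θ₄) = D(θ₁′) · θ₂θ₃θ₄, where D is the
-- Euler derivation of the power series.  The identity amounts to
--   Σ χ₋₄(u) (−1)^c u (k − 2u²) = 0 over u² + x² + 4b² + 4c² = k with u, x odd.
-- This is the third-order part of θ₁(2z)θ₂θ₃θ₄ = 2 θ₁(z)θ₂(z)θ₃(z)θ₄(z), and it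
-- follows from two isometries of ℤ⁴, namely half the Hadamard matrix and the reflection in
-- (1,1,1,1), each preserving one half of the solution set.
module Submission where

open import Defs
open import Data.Nat using (ℕ; _+_; _*_; _%_; _>_)
open import Data.Nat.Divisibility using (_∣_)
open import Data.Nat.Primality using (Prime)
open import Data.Integer using (+_; -[1+_])
open import Data.List using (_∷_; [])
open import Data.Sum using (_⊎_)
open import Data.Product using (Σ; _×_)
open import Relation.Binary.PropositionalEquality using (_≡_)

open import Data.Bool using (Bool; true; false)
open import Data.Empty using (⊥; ⊥-elim)
open import Data.Integer using (ℤ; ∣_∣; 0ℤ; 1ℤ; -1ℤ) renaming (_+_ to _⊕_; _*_ to _⊛_; _-_ to _⊖_; -_ to neg)
import Data.Integer as ℤ
import Data.Integer.Properties as ℤₚ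
open import Data.Integer.Tactic.RingSolver using (solve-∀)
open import Data.List using (List; map; concatMap; filter; length; upTo; _++_)
open import Data.List.Membership.Propositional using (_∈_; lose)
open import Data.List.Membership.Propositional.Properties using (∈-map⁺; ∈-map⁻; ∈-filter⁺; ∈-filter⁻; ∈-++⁺ˡ; ∈-++⁺ʳ; ∈-++⁻; ∈-upTo⁺; ∈-upTo⁻)
open import Data.List.Membership.Propositional.Properties.WithK using (unique∧set⇒bag)
open import Data.List.Properties using (map-++; map-∘)
open import Data.List.Relation.Binary.BagAndSetEquality using (∼bag⇒↭)
open import Data.List.Relation.Binary.Permutation.Propositional using (_↭_; refl; prep; swap)
open import Data.List.Relation.Unary.All as All using ([]; _∷_)
open import Data.List.Relation.Unary.AllPairs using ([]; _∷_)
open import Data.List.Relation.Unary.Any using (here; there; any?)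
open import Data.List.Relation.Unary.Unique.Propositional using (Unique)
import Data.List.Relation.Unary.Unique.Propositional.Properties as Uniq
open import Data.Nat as ℕ using (zero; suc)
import Data.Nat.DivMod as DM
open import Data.Nat.Divisibility using (divides; _∣?_)
open import Data.Nat.Induction using (<-rec)
import Data.Nat.Properties as ℕₚ
open import Data.Product using (∃; _,_; proj₁; proj₂)
open import Data.Sum using (inj₁; inj₂; [_,_]′)
open import Data.Unit using (⊤; tt)
open import Function using (_∘_; id; mk⇔)
open import Relation.Binary.PropositionalEquality using (_≢_; refl; sym; trans; cong; cong₂; subst; module ≡-Reasoning)
open import Relation.Nullary using (¬_; yes; no)
open import Relation.Nullary.Decidable using (¬?; from-no)
open import Relation.Unary using (Decidable)

-- Sums over enumerated predicates

-- The list is complete and free of duplicates, so a sum over it depends on the predicate alone and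
-- can be carried along bijections.
record Enum {A : Set} (P : A → Set) : Set where
  field
    list     : List A
    unique   : Unique list
    sound    : ∀ {x} → x ∈ list → P x
    complete : ∀ {x} → P x → x ∈ list
open Enum

sumOf : {A : Set} → (A → ℤ) → List A → ℤ
sumOf f []       = 0ℤ
sumOf f (x ∷ xs) = f x ⊕ sumOf f xs

∑ : {A : Set} {P : A → Set} → Enum P → (A → ℤ) → ℤ
∑ E f = sumOf f (list E)

module _ {A : Set} where

  sumOf-cong : {f g : A → ℤ} (xs : List A) → (∀ {x} → x ∈ xs → f x ≡ g x) → sumOf f xs ≡ sumOf g xs
  sumOf-cong []       h = refl
  sumOf-cong (x ∷ xs) h = cong₂ _⊕_ (h (here refl)) (sumOf-cong xs (h ∘ there))

  sumOf-++ : (f : A → ℤ) (xs ys : List A) → sumOf f (xs ++ ys) ≡ sumOf f xs ⊕ sumOf f ys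
  sumOf-++ f []       ys = sym (ℤₚ.+-identityˡ _)
  sumOf-++ f (x ∷ xs) ys = begin
    f x ⊕ sumOf f (xs ++ ys)         ≡⟨ cong (f x ⊕_) (sumOf-++ f xs ys) ⟩
    f x ⊕ (sumOf f xs ⊕ sumOf f ys)  ≡⟨ ℤₚ.+-assoc (f x) _ _ ⟨
    f x ⊕ sumOf f xs ⊕ sumOf f ys    ∎
    where open ≡-Reasoning

  sumOf-↭ : (f : A → ℤ) {xs ys : List A} → xs ↭ ys → sumOf f xs ≡ sumOf f ys
  sumOf-↭ f refl         = refl
  sumOf-↭ f (prep x r)   = cong (f x ⊕_) (sumOf-↭ f r)
  sumOf-↭ f {_ ∷ _ ∷ xs} {_ ∷ _ ∷ ys} (swap x y r) = begin
    f x ⊕ (f y ⊕ sumOf f xs)  ≡⟨ cong (λ s → f x ⊕ (f y ⊕ s)) (sumOf-↭ f r) ⟩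
    f x ⊕ (f y ⊕ sumOf f ys)  ≡⟨ exchange (f x) (f y) (sumOf f ys) ⟩
    f y ⊕ (f x ⊕ sumOf f ys)  ∎
    where
    open ≡-Reasoning
    exchange : ∀ a b c → a ⊕ (b ⊕ c) ≡ b ⊕ (a ⊕ c)
    exchange = solve-∀
  sumOf-↭ f (_↭_.trans r s)  = trans (sumOf-↭ f r) (sumOf-↭ f s)

  sumOf-map : {B : Set} (f : B → ℤ) (σ : A → B) (xs : List A) → sumOf f (map σ xs) ≡ sumOf (f ∘ σ) xs
  sumOf-map f σ []       = refl
  sumOf-map f σ (x ∷ xs) = cong (f (σ x) ⊕_) (sumOf-map f σ xs)

  sumOf-+ : (f g : A → ℤ) (xs : List A) → sumOf (λ x → f x ⊕ g x) xs ≡ sumOf f xs ⊕ sumOf g xs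
  sumOf-+ f g []       = refl
  sumOf-+ f g (x ∷ xs) =
    trans (cong (f x ⊕ g x ⊕_) (sumOf-+ f g xs)) (interchange (f x) (g x) (sumOf f xs) (sumOf g xs))
    where
    interchange : ∀ a b c d → a ⊕ b ⊕ (c ⊕ d) ≡ a ⊕ c ⊕ (b ⊕ d)
    interchange = solve-∀

  sumOf-* : (k : ℤ) (f : A → ℤ) (xs : List A) → sumOf (λ x → k ⊛ f x) xs ≡ k ⊛ sumOf f xs
  sumOf-* k f []       = sym (ℤₚ.*-zeroʳ k)
  sumOf-* k f (x ∷ xs) =
    trans (cong (k ⊛ f x ⊕_) (sumOf-* k f xs)) (sym (ℤₚ.*-distribˡ-+ k (f x) (sumOf f xs)))

  sumOf-0 : (xs : List A) {f : A → ℤ} → (∀ {x} → x ∈ xs → f x ≡ 0ℤ) → sumOf f xs ≡ 0ℤ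
  sumOf-0 []       h = refl
  sumOf-0 (x ∷ xs) h = cong₂ _⊕_ (h (here refl)) (sumOf-0 xs (h ∘ there))

  sumOf-filter : {Q : A → Set} (Q? : Decidable Q) (f : A → ℤ) (xs : List A) →
    sumOf f xs ≡ sumOf f (filter Q? xs) ⊕ sumOf f (filter (¬? ∘ Q?) xs)
  sumOf-filter Q? f [] = refl
  sumOf-filter Q? f (x ∷ xs) with Q? x
  ... | yes _ = trans (cong (f x ⊕_) (sumOf-filter Q? f xs)) (sym (ℤₚ.+-assoc (f x) _ _))
  ... | no  _ = trans (cong (f x ⊕_) (sumOf-filter Q? f xs)) (exchange (f x) (sumOf f (filter Q? xs)) _)
    where
    exchange : ∀ a b c → a ⊕ (b ⊕ c) ≡ b ⊕ (a ⊕ c)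
    exchange = solve-∀

  length-as-sum : (xs : List A) → + length xs ≡ sumOf (λ _ → 1ℤ) xs
  length-as-sum []       = refl
  length-as-sum (x ∷ xs) = cong (1ℤ ⊕_) (length-as-sum xs)

  -- The inverse is asked for only on members of the list, because the later isometries, which
  -- involve `half`, are inverted only under a parity condition.
  map-unique : {B : Set} {σ : A → B} {τ : B → A} {xs : List A} →
    (∀ {x} → x ∈ xs → τ (σ x) ≡ x) → Unique xs → Unique (map σ xs)
  map-unique {xs = []}     inv u       = []
  map-unique {σ = σ} {τ} {x ∷ xs} inv (d ∷ u) = All.tabulate distinct ∷ map-unique {τ = τ} (inv ∘ there) u
    where
    distinct : ∀ {y} → y ∈ map σ xs → σ x ≢ y
    distinct y∈ eq with ∈-map⁻ σ y∈
    ... | z , z∈ , refl = All.lookup d z∈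
      (trans (sym (inv (here refl))) (trans (cong τ eq) (inv (there z∈))))

sumOf-concatMap : {A B : Set} (f : B → ℤ) (σ : A → List B) (xs : List A) →
  sumOf f (concatMap σ xs) ≡ sumOf (λ x → sumOf f (σ x)) xs
sumOf-concatMap f σ []       = refl
sumOf-concatMap f σ (x ∷ xs) =
  trans (sumOf-++ f (σ x) (concatMap σ xs)) (cong (sumOf f (σ x) ⊕_) (sumOf-concatMap f σ xs))

module _ {A : Set} {P : A → Set} (E : Enum P) where

  ∑-cong : {f g : A → ℤ} → (∀ x → P x → f x ≡ g x) → ∑ E f ≡ ∑ E g
  ∑-cong h = sumOf-cong (list E) (λ x∈ → h _ (sound E x∈))

  ∑-+ : (f g : A → ℤ) → ∑ E (λ x → f x ⊕ g x) ≡ ∑ E f ⊕ ∑ E g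
  ∑-+ f g = sumOf-+ f g (list E)

  ∑-* : (k : ℤ) (f : A → ℤ) → ∑ E (λ x → k ⊛ f x) ≡ k ⊛ ∑ E f
  ∑-* k f = sumOf-* k f (list E)

  ∑-0 : {f : A → ℤ} → (∀ x → P x → f x ≡ 0ℤ) → ∑ E f ≡ 0ℤ
  ∑-0 h = sumOf-0 (list E) (λ x∈ → h _ (sound E x∈))

  -- The image of the first list has no repetitions and the same members as the second; such lists
  -- are equal as bags, hence permutations of each other.
  ∑-reindex : {B : Set} {Q : B → Set} (F : Enum Q) (σ : A → B) (τ : B → A) →
    (∀ x → P x → Q (σ x)) → (∀ y → Q y → P (τ y)) →
    (∀ x → P x → τ (σ x) ≡ x) → (∀ y → Q y → σ (τ y) ≡ y) →
    (f : A → ℤ) (g : B → ℤ) → (∀ x → P x → f x ≡ g (σ x)) → ∑ E f ≡ ∑ F g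
  ∑-reindex F σ τ σQ τP τσ στ f g fg = begin
    sumOf f (list E)          ≡⟨ ∑-cong fg ⟩
    sumOf (g ∘ σ) (list E)    ≡⟨ sumOf-map g σ (list E) ⟨
    sumOf g (map σ (list E))  ≡⟨ sumOf-↭ g (∼bag⇒↭ (unique∧set⇒bag imageUnique (unique F) (mk⇔ to from))) ⟩
    sumOf g (list F)          ∎
    where
    open ≡-Reasoning
    imageUnique : Unique (map σ (list E))
    imageUnique = map-unique {τ = τ} (λ x∈ → τσ _ (sound E x∈)) (unique E)
    to : ∀ {y} → y ∈ map σ (list E) → y ∈ list F
    to y∈ with ∈-map⁻ σ y∈
    ... | x , x∈ , refl = complete F (σQ x (sound E x∈))
    from : ∀ {y} → y ∈ list F → y ∈ map σ (list E)
    from y∈ = subst (_∈ map σ (list E)) (στ _ (sound F y∈))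
                (∈-map⁺ σ (complete E (τP _ (sound F y∈))))

  ∑-involution : (σ : A → A) → (∀ x → P x → P (σ x)) → (∀ x → P x → σ (σ x) ≡ x) →
    (f g : A → ℤ) → (∀ x → P x → f x ≡ g (σ x)) → ∑ E f ≡ ∑ E g
  ∑-involution σ σP σσ = ∑-reindex E σ σ σP σP σσ σσ

  restrict : {Q : A → Set} → Decidable Q → Enum (λ x → P x × Q x)
  restrict Q? = record
    { list     = filter Q? (list E)
    ; unique   = Uniq.filter⁺ Q? (unique E)
    ; sound    = λ x∈ → let y∈ , q = ∈-filter⁻ Q? {xs = list E} x∈ in sound E y∈ , q
    ; complete = λ (p , q) → ∈-filter⁺ Q? (complete E p) q
    }

  ∑-split : {Q : A → Set} (Q? : Decidable Q) (f : A → ℤ) →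
    ∑ E f ≡ ∑ (restrict Q?) f ⊕ ∑ (restrict (¬? ∘ Q?)) f
  ∑-split Q? f = sumOf-filter Q? f (list E)

  equivalent : {Q : A → Set} → (∀ x → P x → Q x) → (∀ x → Q x → P x) → Enum Q
  equivalent to from = record
    { list     = list E
    ; unique   = unique E
    ; sound    = λ x∈ → to _ (sound E x∈)
    ; complete = λ q → complete E (from _ q)
    }

∑-unique : {A : Set} {P : A → Set} (E F : Enum P) (f : A → ℤ) → ∑ E f ≡ ∑ F f
∑-unique E F f = ∑-reindex E F id id (λ _ → id) (λ _ → id) (λ _ _ → refl) (λ _ _ → refl) f f (λ _ _ → refl)

module _ {A B : Set} {P : A → Set} {R : A → B → Set} (E : Enum P) (F : ∀ a → Enum (R a)) where

  private
    fibre : A → List (A × B)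
    fibre a = map (a ,_) (list (F a))

    ∈-fibres⁻ : ∀ {a b} (as : List A) → (a , b) ∈ concatMap fibre as → a ∈ as × b ∈ list (F a)
    ∈-fibres⁻ (c ∷ as) h with ∈-++⁻ (fibre c) h
    ... | inj₂ h′ = let a∈ , b∈ = ∈-fibres⁻ as h′ in there a∈ , b∈
    ... | inj₁ h′ with ∈-map⁻ (c ,_) h′
    ...   | b , b∈ , refl = here refl , b∈

    ∈-fibres⁺ : ∀ {a b} {as : List A} → a ∈ as → b ∈ list (F a) → (a , b) ∈ concatMap fibre as
    ∈-fibres⁺ {as = c ∷ as} (here refl) b∈ = ∈-++⁺ˡ (∈-map⁺ (c ,_) b∈)
    ∈-fibres⁺ {as = c ∷ as} (there a∈)  b∈ = ∈-++⁺ʳ (fibre c) (∈-fibres⁺ a∈ b∈)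

    fibres-unique : (as : List A) → Unique as → Unique (concatMap fibre as)
    fibres-unique []       _       = []
    fibres-unique (c ∷ as) (d ∷ u) =
      Uniq.++⁺ (Uniq.map⁺ (cong proj₂) (unique (F c))) (fibres-unique as u) disjoint
      where
      disjoint : ∀ {v} → v ∈ fibre c × v ∈ concatMap fibre as → ⊥
      disjoint (h , h′) with ∈-map⁻ (c ,_) h
      ... | b , _ , refl = All.lookup d (proj₁ (∈-fibres⁻ as h′)) refl

  -- The second enumeration may depend on the first coordinate, which is what slicing a level set
  -- requires.
  pairs : Enum (λ ((a , b) : A × B) → P a × R a b)
  pairs = record
    { list     = concatMap fibre (list E)
    ; unique   = fibres-unique (list E) (unique E)
    ; sound    = λ h → let a∈ , b∈ = ∈-fibres⁻ (list E) h in sound E a∈ , sound (F _) b∈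
    ; complete = λ (p , r) → ∈-fibres⁺ (complete E p) (complete (F _) r)
    }

  ∑-pairs : (f : A × B → ℤ) → ∑ pairs f ≡ ∑ E (λ a → ∑ (F a) (λ b → f (a , b)))
  ∑-pairs f = trans (sumOf-concatMap f fibre (list E))
    (sumOf-cong (list E) (λ {a} _ → sumOf-map f (a ,_) (list (F a))))

-- Listed by `intRange`, from which `box` is built as well; this makes `box-cube` an equality of
-- lists.
interval : (B : ℕ) → Enum (λ x → ∣ x ∣ ℕ.≤ B)
interval B = record
  { list     = intRange B
  ; unique   = Uniq.++⁺ (Uniq.map⁺ ℤₚ.+-injective (Uniq.upTo⁺ (suc B)))
                        (Uniq.map⁺ ℤₚ.-[1+-injective (Uniq.upTo⁺ B)) disjoint
  ; sound    = sound′
  ; complete = complete′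
  }
  where
  disjoint : ∀ {v} → v ∈ map (λ i → + i) (upTo (suc B)) × v ∈ map (λ i → -[1+ i ]) (upTo B) → ⊥
  disjoint (h , h′) with ∈-map⁻ (λ i → + i) h | ∈-map⁻ (λ i → -[1+ i ]) h′
  ... | _ , _ , refl | _ , _ , ()
  sound′ : ∀ {x} → x ∈ intRange B → ∣ x ∣ ℕ.≤ B
  sound′ h with ∈-++⁻ (map (λ i → + i) (upTo (suc B))) h
  ... | inj₁ h′ with ∈-map⁻ (λ i → + i) h′
  ...   | _ , i∈ , refl = ℕ.s≤s⁻¹ (∈-upTo⁻ i∈)
  sound′ h | inj₂ h′ with ∈-map⁻ (λ i → -[1+ i ]) h′
  ...   | _ , i∈ , refl = ∈-upTo⁻ i∈
  complete′ : ∀ {x} → ∣ x ∣ ℕ.≤ B → x ∈ intRange B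
  complete′ {+ i}      le = ∈-++⁺ˡ (∈-map⁺ (λ i → + i) (∈-upTo⁺ (ℕ.s≤s le)))
  complete′ { -[1+ i ]} le = ∈-++⁺ʳ _ (∈-map⁺ (λ i → -[1+ i ]) (∈-upTo⁺ le))

-- Parity and signs

parity : ∀ z → ∃ λ h → z ≡ h ⊕ h ⊎ z ≡ 1ℤ ⊕ (h ⊕ h)
parity (+ zero)   = 0ℤ , inj₁ refl
parity (+ suc n)  with parity (+ n)
... | h , inj₁ eq = h , inj₂ (cong ℤ.suc eq)
... | h , inj₂ eq = 1ℤ ⊕ h , inj₁ (trans (cong ℤ.suc eq) (carry h))
  where
  carry : ∀ h → 1ℤ ⊕ (1ℤ ⊕ (h ⊕ h)) ≡ 1ℤ ⊕ h ⊕ (1ℤ ⊕ h)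
  carry = solve-∀
parity -[1+ zero ]  = -1ℤ , inj₂ refl
parity -[1+ suc n ] with parity -[1+ n ]
... | h , inj₁ eq = -1ℤ ⊕ h , inj₂ (trans (cong ℤ.pred eq) (borrow h))
  where
  borrow : ∀ h → -1ℤ ⊕ (h ⊕ h) ≡ 1ℤ ⊕ (-1ℤ ⊕ h ⊕ (-1ℤ ⊕ h))
  borrow = solve-∀
... | h , inj₂ eq = h , inj₁ (trans (cong ℤ.pred eq) (cancel h))
  where
  cancel : ∀ h → -1ℤ ⊕ (1ℤ ⊕ (h ⊕ h)) ≡ h ⊕ h
  cancel = solve-∀

half : ℤ → ℤ
half z = proj₁ (parity z)

-- Stated with the computed candidate `half z`, so that a proof is at once the equation z = 2h for
-- the very h that enters the isometries.
Even : ℤ → Set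
Even z = z ≡ half z ⊕ half z

double-injective : ∀ {h k} → h ⊕ h ≡ k ⊕ k → h ≡ k
double-injective {h} {k} eq = ℤₚ.*-cancelˡ-≡ (+ 2) h k (trans (twice h) (trans eq (sym (twice k))))
  where
  twice : ∀ z → + 2 ⊛ z ≡ z ⊕ z
  twice = solve-∀

even≢odd : ∀ {h k} → h ⊕ h ≢ 1ℤ ⊕ (k ⊕ k)
even≢odd {h} {k} eq = no-unit (h ⊖ k) (trans (move h k) (trans (cong (_⊖ (k ⊕ k)) eq) (cancel k)))
  where
  move : ∀ h k → (h ⊖ k) ⊕ (h ⊖ k) ≡ (h ⊕ h) ⊖ (k ⊕ k)
  move = solve-∀
  cancel : ∀ k → 1ℤ ⊕ (k ⊕ k) ⊖ (k ⊕ k) ≡ 1ℤ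
  cancel = solve-∀
  no-unit : ∀ d → d ⊕ d ≢ 1ℤ
  no-unit (+ zero)        ()
  no-unit (+ suc zero)    ()
  no-unit (+ suc (suc n)) ()
  no-unit -[1+ n ]        ()

half-double : ∀ h → half (h ⊕ h) ≡ h
half-double h with parity (h ⊕ h)
... | k , inj₁ eq = sym (double-injective eq)
... | k , inj₂ eq = ⊥-elim (even≢odd {h} {k} eq)

double-even : ∀ {z} h → z ≡ h ⊕ h → Even z
double-even h refl = cong₂ _⊕_ (sym (half-double h)) (sym (half-double h))

odd-not-even : ∀ {z} h → z ≡ 1ℤ ⊕ (h ⊕ h) → ¬ Even z
odd-not-even {z} h odd even = even≢odd {half z} {h} (trans (sym even) odd)

even? : Decidable Even
even? z = let h , cases = parity z in [ yes ∘ double-even h , no ∘ odd-not-even h ]′ cases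

not-even : ∀ {z} → ¬ Even z → ∃ λ h → z ≡ 1ℤ ⊕ (h ⊕ h)
not-even {z} ne = let h , cases = parity z in [ ⊥-elim ∘ ne ∘ double-even h , h ,_ ]′ cases

-- The character (-1)^z. At the index i of an odd number u = 2i + 1 its value is χ₋₄(u).
sgn : ℤ → ℤ
sgn (+ zero)      = 1ℤ
sgn (+ suc n)     = neg (sgn (+ n))
sgn -[1+ zero ]   = -1ℤ
sgn -[1+ suc n ]  = neg (sgn -[1+ n ])

sgn-suc : ∀ z → sgn (1ℤ ⊕ z) ≡ neg (sgn z)
sgn-suc (+ n)          = refl
sgn-suc -[1+ zero ]    = refl
sgn-suc -[1+ suc n ]   = sym (ℤₚ.neg-involutive _)

sgn-pred : ∀ z → sgn (-1ℤ ⊕ z) ≡ neg (sgn z)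
sgn-pred (+ zero)   = refl
sgn-pred (+ suc n)  = sym (ℤₚ.neg-involutive _)
sgn-pred -[1+ n ]   = refl

sgn-+ : ∀ y z → sgn (y ⊕ z) ≡ sgn y ⊛ sgn z
sgn-+ (+ zero)  z = trans (cong sgn (ℤₚ.+-identityˡ z)) (sym (ℤₚ.*-identityˡ (sgn z)))
sgn-+ (+ suc n) z = begin
  sgn (1ℤ ⊕ + n ⊕ z)       ≡⟨ cong sgn (ℤₚ.+-assoc 1ℤ (+ n) z) ⟩
  sgn (1ℤ ⊕ (+ n ⊕ z))     ≡⟨ sgn-suc (+ n ⊕ z) ⟩
  neg (sgn (+ n ⊕ z))      ≡⟨ cong neg (sgn-+ (+ n) z) ⟩
  neg (sgn (+ n) ⊛ sgn z)  ≡⟨ ℤₚ.neg-distribˡ-* (sgn (+ n)) (sgn z) ⟩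
  neg (sgn (+ n)) ⊛ sgn z  ∎
  where open ≡-Reasoning
sgn-+ -[1+ zero ]  z = trans (sgn-pred z) (sym (ℤₚ.-1*i≡-i (sgn z)))
sgn-+ -[1+ suc n ] z = begin
  sgn (-1ℤ ⊕ -[1+ n ] ⊕ z)    ≡⟨ cong sgn (ℤₚ.+-assoc -1ℤ -[1+ n ] z) ⟩
  sgn (-1ℤ ⊕ (-[1+ n ] ⊕ z))  ≡⟨ sgn-pred (-[1+ n ] ⊕ z) ⟩
  neg (sgn (-[1+ n ] ⊕ z))    ≡⟨ cong neg (sgn-+ -[1+ n ] z) ⟩
  neg (sgn -[1+ n ] ⊛ sgn z)  ≡⟨ ℤₚ.neg-distribˡ-* (sgn -[1+ n ]) (sgn z) ⟩
  neg (sgn -[1+ n ]) ⊛ sgn z  ∎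
  where open ≡-Reasoning

sgn-double : ∀ h → sgn (h ⊕ h) ≡ 1ℤ
sgn-double (+ zero)     = refl
sgn-double (+ suc n)    = trans (cong sgn (carry (+ n))) (trans (sgn-+ (+ 2) (+ n ⊕ + n)) (trans (ℤₚ.*-identityˡ _) (sgn-double (+ n))))
  where
  carry : ∀ h → 1ℤ ⊕ h ⊕ (1ℤ ⊕ h) ≡ + 2 ⊕ (h ⊕ h)
  carry = solve-∀
sgn-double -[1+ zero ]  = refl
sgn-double -[1+ suc n ] = trans (cong sgn (carry -[1+ n ])) (trans (sgn-+ (ℤ.- + 2) (-[1+ n ] ⊕ -[1+ n ])) (trans (ℤₚ.*-identityˡ _) (sgn-double -[1+ n ])))
  where
  carry : ∀ h → -1ℤ ⊕ h ⊕ (-1ℤ ⊕ h) ≡ ℤ.- + 2 ⊕ (h ⊕ h)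
  carry = solve-∀

sgn-odd : ∀ h → sgn (1ℤ ⊕ (h ⊕ h)) ≡ -1ℤ
sgn-odd h = trans (sgn-suc (h ⊕ h)) (cong neg (sgn-double h))

sgn-shift : ∀ z h → sgn (z ⊕ (h ⊕ h)) ≡ sgn z
sgn-shift z h = trans (sgn-+ z (h ⊕ h)) (trans (cong (sgn z ⊛_) (sgn-double h)) (ℤₚ.*-identityʳ (sgn z)))

-- Level sets of positive diagonal forms

sq odd² : ℤ → ℤ
sq x = x ⊛ x
odd² i = sq (+ 2 ⊛ i ⊕ 1ℤ)

-- Nonnegativity serves twice: it bounds the leading variable when a variable is adjoined, and it
-- empties the level sets at negative integers.
record Form (A : Set) : Set where
  field
    value    : A → ℤ
    nonneg   : ∀ a → 0ℤ ℤ.≤ value a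
    level    : ∀ k → Enum (λ a → value a ≡ k)
open Form

-- This growth condition makes level sets finite: w x ≤ k confines x to the interval of radius |k|.
Coercive : (ℤ → ℤ) → Set
Coercive w = ∀ x → + ∣ x ∣ ℤ.≤ w x

coercive-nonneg : ∀ {w} → Coercive w → ∀ x → 0ℤ ℤ.≤ w x
coercive-nonneg cw x = ℤₚ.≤-trans (ℤ.+≤+ ℕ.z≤n) (cw x)

coercive-bound : ∀ {w} → Coercive w → ∀ x {k} → w x ℤ.≤ k → ∣ x ∣ ℕ.≤ ∣ k ∣
coercive-bound cw x {k} le with k | ℤₚ.≤-trans (cw x) le
... | + n | ℤ.+≤+ h = h

⟨_⟩ : ∀ {w} → Coercive w → Form ℤ
⟨_⟩ {w} cw = record
  { value  = w
  ; nonneg = coercive-nonneg cw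
  ; level  = λ k → equivalent (restrict (interval ∣ k ∣) (λ x → w x ℤ.≟ k))
                     (λ _ → proj₂) (λ x eq → coercive-bound cw x (ℤₚ.≤-reflexive eq) , eq)
  }

transpose : ∀ {a b k} → b ≡ k ⊖ a → a ⊕ b ≡ k
transpose {a} {_} {k} refl = cancel a k
  where
  cancel : ∀ a k → a ⊕ (k ⊖ a) ≡ k
  cancel = solve-∀

transpose⁻ : ∀ {a b k} → a ⊕ b ≡ k → b ≡ k ⊖ a
transpose⁻ {a} {b} refl = cancel a b
  where
  cancel : ∀ a b → b ≡ a ⊕ b ⊖ a
  cancel = solve-∀

infixr 5 _⊞_
_⊞_ : ∀ {w} {A : Set} → Coercive w → Form A → Form (ℤ × A)
_⊞_ {w} cw F = record
  { value  = λ (x , a) → w x ⊕ value F a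
  ; nonneg = λ (x , a) → ℤₚ.+-mono-≤ (coercive-nonneg cw x) (nonneg F a)
  ; level  = λ k → equivalent (pairs (interval ∣ k ∣) (λ x → level F (k ⊖ w x)))
      (λ _ (_ , eq) → transpose eq)
      (λ (x , a) eq → coercive-bound cw x (bound x a eq) , transpose⁻ eq)
  }
  where
  bound : ∀ x a {k} → w x ⊕ value F a ≡ k → w x ℤ.≤ k
  bound x a refl = subst (ℤ._≤ w x ⊕ value F a) (ℤₚ.+-identityʳ (w x)) (ℤₚ.+-monoʳ-≤ (w x) (nonneg F a))

-- In terms of theta series this is the multiplication of power series: adjoining a variable
-- multiplies by one more factor.
∑-⊞ : ∀ {w} {A : Set} (cw : Coercive w) (F : Form A) k (f : ℤ × A → ℤ) →
  ∑ (level (cw ⊞ F) k) f ≡ ∑ (interval ∣ k ∣) (λ x → ∑ (level F (k ⊖ w x)) (λ a → f (x , a)))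
∑-⊞ {w} cw F k = ∑-pairs (interval ∣ k ∣) (λ x → level F (k ⊖ w x))

sq-coercive : Coercive sq
sq-coercive (+ zero)  = ℤ.+≤+ ℕ.z≤n
sq-coercive (+ suc n) = ℤ.+≤+ (ℕₚ.m≤m*n (suc n) (suc n))
sq-coercive -[1+ n ]  = ℤ.+≤+ (ℕₚ.m≤m*n (suc n) (suc n))

scale-coercive : ∀ {w} k → Coercive w → Coercive (λ x → + suc k ⊛ w x)
scale-coercive {w} k cw x with w x | cw x
... | + n | ℤ.+≤+ le = subst (+ ∣ x ∣ ℤ.≤_) (ℤₚ.pos-* (suc k) n) (ℤ.+≤+ (ℕₚ.≤-trans le (ℕₚ.m≤n*m n (suc k))))

odd²-coercive : Coercive odd²
odd²-coercive i = ℤₚ.≤-trans (ℤ.+≤+ (lower i)) (sq-coercive (+ 2 ⊛ i ⊕ 1ℤ))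
  where
  lower : ∀ i → ∣ i ∣ ℕ.≤ ∣ + 2 ⊛ i ⊕ 1ℤ ∣
  lower (+ n) = subst (n ℕ.≤_) (cong ∣_∣ (cong (_⊕ 1ℤ) (ℤₚ.pos-* 2 n)))
                  (ℕₚ.≤-trans (ℕₚ.m≤n*m n 2) (ℕₚ.m≤m+n (2 ℕ.* n) 1))
  lower -[1+ n ] = subst (suc n ℕ.≤_) (cong ∣_∣ (sym (reflect (+ n)))) (ℕ.s≤s (ℕₚ.m≤m+n n n))
    where
    reflect : ∀ x → + 2 ⊛ neg (1ℤ ⊕ x) ⊕ 1ℤ ≡ neg (1ℤ ⊕ (x ⊕ x))
    reflect = solve-∀

-- The cubic identity on ℤ⁴

4sq-coercive : Coercive (λ x → + 4 ⊛ sq x)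
4sq-coercive = scale-coercive 3 sq-coercive

ternary : Form (ℤ × ℤ × ℤ)
ternary = odd²-coercive ⊞ 4sq-coercive ⊞ ⟨ 4sq-coercive ⟩

quaternary : Form (ℤ × ℤ × ℤ × ℤ)
quaternary = odd²-coercive ⊞ ternary

odd : ℤ → ℤ
odd i = + 2 ⊛ i ⊕ 1ℤ

-- Let u be the first coordinate of a vector of norm k. Averaging s³ over the signs of the other
-- coordinates of the sum s gives 3uk - 2u³. The linear term is chosen so that this average becomes
-- u(k - 2u²), while the value at s = 2u becomes -4u(k - 2u²).
cubic : ℤ → ℤ → ℤ
cubic k s = s ⊛ s ⊛ s ⊖ + 2 ⊛ k ⊛ s

-- (i , j , b , c) stands for the vector (2i+1, 2j+1, 2b, 2c), whose coordinate sum is spread = 2 (indexSum + 1).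
indexSum spread ε : ℤ × ℤ × ℤ × ℤ → ℤ
indexSum (i , j , b , c) = i ⊕ j ⊕ b ⊕ c
spread (i , j , b , c) = odd i ⊕ odd j ⊕ + 2 ⊛ b ⊕ + 2 ⊛ c
ε (i , j , b , c) = sgn (i ⊕ c)

negOdd : ∀ j → + 2 ⊛ (-1ℤ ⊖ j) ⊕ 1ℤ ≡ neg (+ 2 ⊛ j ⊕ 1ℤ)
negOdd = solve-∀

negOdd-involutive : ∀ j → -1ℤ ⊖ (-1ℤ ⊖ j) ≡ j
negOdd-involutive = solve-∀

sq-neg : ∀ x → neg x ⊛ neg x ≡ x ⊛ x
sq-neg = solve-∀

odd²-negOdd : ∀ j → odd² (-1ℤ ⊖ j) ≡ odd² j
odd²-negOdd j = trans (cong sq (negOdd j)) (sq-neg (odd j))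

selfNeg : ∀ {x} → x ≡ -1ℤ ⊛ x → x ≡ 0ℤ
selfNeg {x} eq = double-injective {x} {0ℤ} (trans (cong (x ⊕_) eq) (cancel x))
  where
  cancel : ∀ x → x ⊕ -1ℤ ⊛ x ≡ 0ℤ
  cancel = solve-∀

-- Eliminating the last coordinate turns identities that hold only under a condition on the index
-- sum into polynomial identities.
solveLast : ∀ i j b c {z} → i ⊕ j ⊕ b ⊕ c ≡ z → c ≡ z ⊖ i ⊖ j ⊖ b
solveLast i j b c refl = cancel i j b c
  where
  cancel : ∀ i j b c → c ≡ i ⊕ j ⊕ b ⊕ c ⊖ i ⊖ j ⊖ b
  cancel = solve-∀

module _ (k : ℤ) where

  private
    S  = level quaternary k
    -- The coordinate sum is 2 modulo 4 on `S⁺` and 0 modulo 4 on `S⁻`.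
    S⁺ = restrict S (even? ∘ indexSum)
    S⁻ = restrict S (¬? ∘ even? ∘ indexSum)

    cubicSpread cubicDouble derivative : ℤ × ℤ × ℤ × ℤ → ℤ
    cubicSpread v       = ε v ⊛ cubic k (spread v)
    cubicDouble v       = ε v ⊛ cubic k (+ 2 ⊛ odd (proj₁ v))
    derivative v@(i , _) = ε v ⊛ (odd i ⊛ (k ⊖ + 2 ⊛ odd² i))

    -- The reflection in (1,1,1,1); it is integral on S⁻ and negates spread.
    reflect : ℤ × ℤ × ℤ × ℤ → ℤ × ℤ × ℤ × ℤ
    reflect v@(i , j , b , c) = i ⊖ r , j ⊖ r , b ⊖ r , c ⊖ r
      where r = half (indexSum v ⊕ 1ℤ)

    -- Half the Hadamard matrix; it is integral on S⁺ and exchanges spread with twice the first coordinate.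
    hadamard : ℤ × ℤ × ℤ × ℤ → ℤ × ℤ × ℤ × ℤ
    hadamard v@(i , j , b , c) = h , i ⊕ j ⊖ h , i ⊕ b ⊖ h , i ⊕ c ⊖ h
      where h = half (indexSum v)

  -- The reflection subtracts r, a quarter of the coordinate sum, from every index. So i + c changes
  -- by 2r and `ε` is kept, whereas `cubic` is odd in the negated sum: the terms cancel.
  ∑S⁻-cubicSpread : ∑ S⁻ cubicSpread ≡ 0ℤ
  ∑S⁻-cubicSpread = selfNeg (trans (∑-involution S⁻ reflect preserves involutive cubicSpread (λ v → -1ℤ ⊛ cubicSpread v) antisym)
                                   (∑-* S⁻ -1ℤ cubicSpread))
    where
    halfSum : ∀ {z} → ¬ Even z → z ≡ half (z ⊕ 1ℤ) ⊕ half (z ⊕ 1ℤ) ⊖ 1ℤ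
    halfSum {z} ne = trans (sym (cancel z)) (cong (_⊖ 1ℤ) (double-even (1ℤ ⊕ proj₁ (not-even ne))
        (trans (cong (_⊕ 1ℤ) (proj₂ (not-even ne))) (carry (proj₁ (not-even ne))))))
      where
      cancel : ∀ z → z ⊕ 1ℤ ⊖ 1ℤ ≡ z
      cancel = solve-∀
      carry : ∀ h → 1ℤ ⊕ (h ⊕ h) ⊕ 1ℤ ≡ 1ℤ ⊕ h ⊕ (1ℤ ⊕ h)
      carry = solve-∀

    valueReflect : ∀ i j b c r → i ⊕ j ⊕ b ⊕ c ≡ r ⊕ r ⊖ 1ℤ →
      value quaternary (i ⊖ r , j ⊖ r , b ⊖ r , c ⊖ r) ≡ value quaternary (i , j , b , c)
    valueReflect i j b c r eq with refl ← solveLast i j b c eq = identity i j b r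
      where
      identity : ∀ i j b r → let c = r ⊕ r ⊖ 1ℤ ⊖ i ⊖ j ⊖ b in
        (+ 2 ⊛ (i ⊖ r) ⊕ 1ℤ) ⊛ (+ 2 ⊛ (i ⊖ r) ⊕ 1ℤ) ⊕ ((+ 2 ⊛ (j ⊖ r) ⊕ 1ℤ) ⊛ (+ 2 ⊛ (j ⊖ r) ⊕ 1ℤ)
          ⊕ (+ 4 ⊛ ((b ⊖ r) ⊛ (b ⊖ r)) ⊕ + 4 ⊛ ((c ⊖ r) ⊛ (c ⊖ r))))
        ≡ (+ 2 ⊛ i ⊕ 1ℤ) ⊛ (+ 2 ⊛ i ⊕ 1ℤ) ⊕ ((+ 2 ⊛ j ⊕ 1ℤ) ⊛ (+ 2 ⊛ j ⊕ 1ℤ) ⊕ (+ 4 ⊛ (b ⊛ b) ⊕ + 4 ⊛ (c ⊛ c)))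
      identity = solve-∀

    indexSumReflect : ∀ i j b c r → i ⊕ j ⊕ b ⊕ c ≡ r ⊕ r ⊖ 1ℤ →
      indexSum (i ⊖ r , j ⊖ r , b ⊖ r , c ⊖ r) ≡ neg r ⊕ neg r ⊖ 1ℤ
    indexSumReflect i j b c r eq with refl ← solveLast i j b c eq = identity i j b r
      where
      identity : ∀ i j b r →
        i ⊖ r ⊕ (j ⊖ r) ⊕ (b ⊖ r) ⊕ (r ⊕ r ⊖ 1ℤ ⊖ i ⊖ j ⊖ b ⊖ r) ≡ neg r ⊕ neg r ⊖ 1ℤ
      identity = solve-∀

    preserves : ∀ v → value quaternary v ≡ k × ¬ Even (indexSum v) →
      value quaternary (reflect v) ≡ k × ¬ Even (indexSum (reflect v))
    preserves v@(i , j , b , c) (eq , ne) =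
      trans (valueReflect i j b c r (halfSum ne)) eq ,
      odd-not-even (neg r ⊖ 1ℤ) (trans (indexSumReflect i j b c r (halfSum ne)) (borrow r))
      where
      r = half (indexSum v ⊕ 1ℤ)
      borrow : ∀ r → neg r ⊕ neg r ⊖ 1ℤ ≡ 1ℤ ⊕ (neg r ⊖ 1ℤ ⊕ (neg r ⊖ 1ℤ))
      borrow = solve-∀

    involutive : ∀ v → value quaternary v ≡ k × ¬ Even (indexSum v) → reflect (reflect v) ≡ v
    involutive v@(i , j , b , c) (eq , ne) = trans
      (cong (λ r′ → i ⊖ r ⊖ r′ , j ⊖ r ⊖ r′ , b ⊖ r ⊖ r′ , c ⊖ r ⊖ r′) opposite)
      (cong₂ _,_ (cancel i r) (cong₂ _,_ (cancel j r) (cong₂ _,_ (cancel b r) (cancel c r))))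
      where
      r = half (indexSum v ⊕ 1ℤ)
      cancel : ∀ x r → x ⊖ r ⊖ neg r ≡ x
      cancel = solve-∀
      cancel1 : ∀ x → x ⊖ 1ℤ ⊕ 1ℤ ≡ x
      cancel1 = solve-∀
      opposite : half (indexSum (reflect v) ⊕ 1ℤ) ≡ neg r
      opposite = trans (cong (half ∘ (_⊕ 1ℤ)) (indexSumReflect i j b c r (halfSum ne)))
        (trans (cong half (cancel1 (neg r ⊕ neg r))) (half-double (neg r)))

    antisym : ∀ v → value quaternary v ≡ k × ¬ Even (indexSum v) →
      cubicSpread v ≡ -1ℤ ⊛ cubicSpread (reflect v)
    antisym v@(i , j , b , c) (_ , ne) = begin
      ε v ⊛ cubic k (spread v)
        ≡⟨ cong₂ (λ e s → e ⊛ cubic k s) εEq (spreadEq i j b c r (halfSum ne)) ⟩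
      ε (reflect v) ⊛ cubic k (neg (spread (reflect v)))
        ≡⟨ oddCubic (ε (reflect v)) k (spread (reflect v)) ⟩
      -1ℤ ⊛ (ε (reflect v) ⊛ cubic k (spread (reflect v)))  ∎
      where
      open ≡-Reasoning
      r = half (indexSum v ⊕ 1ℤ)
      εEq : sgn (i ⊕ c) ≡ sgn (i ⊖ r ⊕ (c ⊖ r))
      εEq = trans (cong sgn (regroup i c r)) (sgn-shift (i ⊖ r ⊕ (c ⊖ r)) r)
        where
        regroup : ∀ i c r → i ⊕ c ≡ i ⊖ r ⊕ (c ⊖ r) ⊕ (r ⊕ r)
        regroup = solve-∀
      spreadEq : ∀ i j b c r → i ⊕ j ⊕ b ⊕ c ≡ r ⊕ r ⊖ 1ℤ →
        spread (i , j , b , c) ≡ neg (spread (i ⊖ r , j ⊖ r , b ⊖ r , c ⊖ r))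
      spreadEq i j b c r eq with refl ← solveLast i j b c eq = identity i j b r
        where
        identity : ∀ i j b r → let c = r ⊕ r ⊖ 1ℤ ⊖ i ⊖ j ⊖ b in
          + 2 ⊛ i ⊕ 1ℤ ⊕ (+ 2 ⊛ j ⊕ 1ℤ) ⊕ + 2 ⊛ b ⊕ + 2 ⊛ c
          ≡ neg (+ 2 ⊛ (i ⊖ r) ⊕ 1ℤ ⊕ (+ 2 ⊛ (j ⊖ r) ⊕ 1ℤ) ⊕ + 2 ⊛ (b ⊖ r) ⊕ + 2 ⊛ (c ⊖ r))
        identity = solve-∀
      oddCubic : ∀ e k s → e ⊛ (neg s ⊛ neg s ⊛ neg s ⊖ + 2 ⊛ k ⊛ neg s) ≡ -1ℤ ⊛ (e ⊛ (s ⊛ s ⊛ s ⊖ + 2 ⊛ k ⊛ s))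
      oddCubic = solve-∀

  -- The new indices h and i + c - h add up to i + c, so `ε` is kept, and the coordinate sum equals
  -- twice the new first coordinate 2h + 1.
  ∑S⁺-cubicSpread : ∑ S⁺ cubicSpread ≡ ∑ S⁺ cubicDouble
  ∑S⁺-cubicSpread = ∑-involution S⁺ hadamard preserves involutive cubicSpread cubicDouble agrees
    where
    valueHadamard : ∀ i j b c h → i ⊕ j ⊕ b ⊕ c ≡ h ⊕ h →
      value quaternary (h , i ⊕ j ⊖ h , i ⊕ b ⊖ h , i ⊕ c ⊖ h) ≡ value quaternary (i , j , b , c)
    valueHadamard i j b c h eq with refl ← solveLast i j b c eq = identity i j b h
      where
      identity : ∀ i j b h → let c = h ⊕ h ⊖ i ⊖ j ⊖ b in
        (+ 2 ⊛ h ⊕ 1ℤ) ⊛ (+ 2 ⊛ h ⊕ 1ℤ) ⊕ ((+ 2 ⊛ (i ⊕ j ⊖ h) ⊕ 1ℤ) ⊛ (+ 2 ⊛ (i ⊕ j ⊖ h) ⊕ 1ℤ)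
          ⊕ (+ 4 ⊛ ((i ⊕ b ⊖ h) ⊛ (i ⊕ b ⊖ h)) ⊕ + 4 ⊛ ((i ⊕ c ⊖ h) ⊛ (i ⊕ c ⊖ h))))
        ≡ (+ 2 ⊛ i ⊕ 1ℤ) ⊛ (+ 2 ⊛ i ⊕ 1ℤ) ⊕ ((+ 2 ⊛ j ⊕ 1ℤ) ⊛ (+ 2 ⊛ j ⊕ 1ℤ) ⊕ (+ 4 ⊛ (b ⊛ b) ⊕ + 4 ⊛ (c ⊛ c)))
      identity = solve-∀

    indexSumHadamard : ∀ i j b c h → i ⊕ j ⊕ b ⊕ c ≡ h ⊕ h →
      indexSum (h , i ⊕ j ⊖ h , i ⊕ b ⊖ h , i ⊕ c ⊖ h) ≡ i ⊕ i
    indexSumHadamard i j b c h eq with refl ← solveLast i j b c eq = identity i j b h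
      where
      identity : ∀ i j b h → let c = h ⊕ h ⊖ i ⊖ j ⊖ b in
        h ⊕ (i ⊕ j ⊖ h) ⊕ (i ⊕ b ⊖ h) ⊕ (i ⊕ c ⊖ h) ≡ i ⊕ i
      identity = solve-∀

    preserves : ∀ v → value quaternary v ≡ k × Even (indexSum v) →
      value quaternary (hadamard v) ≡ k × Even (indexSum (hadamard v))
    preserves v@(i , j , b , c) (eq , ev) =
      trans (valueHadamard i j b c (half (indexSum v)) ev) eq ,
      double-even i (indexSumHadamard i j b c (half (indexSum v)) ev)

    involutive : ∀ v → value quaternary v ≡ k × Even (indexSum v) → hadamard (hadamard v) ≡ v
    involutive v@(i , j , b , c) (_ , ev) = trans
      (cong (λ h′ → h′ , h ⊕ (i ⊕ j ⊖ h) ⊖ h′ , h ⊕ (i ⊕ b ⊖ h) ⊖ h′ , h ⊕ (i ⊕ c ⊖ h) ⊖ h′)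
        (trans (cong half (indexSumHadamard i j b c h ev)) (half-double i)))
      (cong (i ,_) (cong₂ _,_ (cancel h i j) (cong₂ _,_ (cancel h i b) (cancel h i c))))
      where
      h = half (indexSum v)
      cancel : ∀ h i x → h ⊕ (i ⊕ x ⊖ h) ⊖ i ≡ x
      cancel = solve-∀

    agrees : ∀ v → value quaternary v ≡ k × Even (indexSum v) → cubicSpread v ≡ cubicDouble (hadamard v)
    agrees v@(i , j , b , c) (_ , ev) =
      cong₂ (λ e s → e ⊛ cubic k s) (cong sgn (regroup i c h))
        (trans (collect i j b c) (trans (cong (λ z → + 2 ⊛ z ⊕ + 2) ev) (expand h)))
      where
      h = half (indexSum v)
      regroup : ∀ i c h → i ⊕ c ≡ h ⊕ (i ⊕ c ⊖ h)
      regroup = solve-∀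
      collect : ∀ i j b c → + 2 ⊛ i ⊕ 1ℤ ⊕ (+ 2 ⊛ j ⊕ 1ℤ) ⊕ + 2 ⊛ b ⊕ + 2 ⊛ c ≡ + 2 ⊛ (i ⊕ j ⊕ b ⊕ c) ⊕ + 2
      collect = solve-∀
      expand : ∀ h → + 2 ⊛ (h ⊕ h) ⊕ + 2 ≡ + 2 ⊛ (+ 2 ⊛ h ⊕ 1ℤ)
      expand = solve-∀

  private
    flipOdd flipFst flipSnd : ℤ × ℤ × ℤ × ℤ → ℤ × ℤ × ℤ × ℤ
    flipOdd (i , j , b , c) = i , -1ℤ ⊖ j , b , c
    flipFst (i , j , b , c) = i , j , neg b , c
    flipSnd (i , j , b , c) = i , j , b , neg c

    value-flipOdd : ∀ v → value quaternary v ≡ k → value quaternary (flipOdd v) ≡ k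
    value-flipOdd (i , j , b , c) = trans (cong (λ z → odd² i ⊕ (z ⊕ (+ 4 ⊛ sq b ⊕ + 4 ⊛ sq c))) (odd²-negOdd j))

    flipOdd-involutive : ∀ v → flipOdd (flipOdd v) ≡ v
    flipOdd-involutive (i , j , b , c) = cong (λ z → i , z , b , c) (negOdd-involutive j)

  -- Negating the second odd coordinate changes the index sum by an odd number, hence exchanges the
  -- two halves; neither `ε` nor the first coordinate is touched.
  ∑S⁻-cubicDouble : ∑ S⁻ cubicDouble ≡ ∑ S⁺ cubicDouble
  ∑S⁻-cubicDouble = ∑-reindex S⁻ S⁺ flipOdd flipOdd
    (λ v@(i , j , b , c) (eq , ne) → value-flipOdd v eq , toEven i j b c (not-even ne))
    (λ v@(i , j , b , c) (eq , ev) → value-flipOdd v eq , toOdd i j b c ev)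
    (λ v _ → flipOdd-involutive v) (λ v _ → flipOdd-involutive v)
    cubicDouble cubicDouble (λ _ _ → refl)
    where
    flipSum : ∀ i j b c → i ⊕ (-1ℤ ⊖ j) ⊕ b ⊕ c ≡ i ⊕ j ⊕ b ⊕ c ⊖ + 2 ⊛ j ⊖ 1ℤ
    flipSum = solve-∀
    toEven : ∀ i j b c → (∃ λ h → i ⊕ j ⊕ b ⊕ c ≡ 1ℤ ⊕ (h ⊕ h)) → Even (i ⊕ (-1ℤ ⊖ j) ⊕ b ⊕ c)
    toEven i j b c (h , eq) = double-even (h ⊖ j)
      (trans (flipSum i j b c) (trans (cong (λ z → z ⊖ + 2 ⊛ j ⊖ 1ℤ) eq) (regroup h j)))
      where
      regroup : ∀ h j → 1ℤ ⊕ (h ⊕ h) ⊖ + 2 ⊛ j ⊖ 1ℤ ≡ h ⊖ j ⊕ (h ⊖ j)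
      regroup = solve-∀
    toOdd : ∀ i j b c → Even (i ⊕ j ⊕ b ⊕ c) → ¬ Even (i ⊕ (-1ℤ ⊖ j) ⊕ b ⊕ c)
    toOdd i j b c ev = odd-not-even (h ⊖ j ⊖ 1ℤ)
      (trans (flipSum i j b c) (trans (cong (λ z → z ⊖ + 2 ⊛ j ⊖ 1ℤ) ev) (regroup h j)))
      where
      h = half (i ⊕ j ⊕ b ⊕ c)
      regroup : ∀ h j → h ⊕ h ⊖ + 2 ⊛ j ⊖ 1ℤ ≡ 1ℤ ⊕ (h ⊖ j ⊖ 1ℤ ⊕ (h ⊖ j ⊖ 1ℤ))
      regroup = solve-∀

  private
    symmetrise : (ℤ × ℤ × ℤ × ℤ → ℤ × ℤ × ℤ × ℤ) → (ℤ × ℤ × ℤ × ℤ → ℤ) → ℤ × ℤ × ℤ × ℤ → ℤ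
    symmetrise σ f v = f v ⊕ f (σ v)

    ∑-symmetrise : ∀ σ → (∀ v → value quaternary v ≡ k → value quaternary (σ v) ≡ k) → (∀ v → σ (σ v) ≡ v) →
      ∀ f → ∑ S (symmetrise σ f) ≡ + 2 ⊛ ∑ S f
    ∑-symmetrise σ σS σσ f = begin
      ∑ S (symmetrise σ f)    ≡⟨ ∑-+ S f (f ∘ σ) ⟩
      ∑ S f ⊕ ∑ S (f ∘ σ)     ≡⟨ cong (∑ S f ⊕_) (∑-involution S σ σS (λ v _ → σσ v) (f ∘ σ) f (λ _ _ → refl)) ⟩
      ∑ S f ⊕ ∑ S f           ≡⟨ twice (∑ S f) ⟩
      + 2 ⊛ ∑ S f             ∎
      where
      open ≡-Reasoning
      twice : ∀ x → x ⊕ x ≡ + 2 ⊛ x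
      twice = solve-∀

    -- Averaging over the signs of the last three coordinates kills every monomial of the cubic that is odd in one of them.
    symmetrised : ∀ v → value quaternary v ≡ k →
      symmetrise flipSnd (symmetrise flipFst (symmetrise flipOdd cubicSpread)) v ≡ + 8 ⊛ derivative v
    symmetrised (i , j , b , c) eq = begin
      Φ (sgn (i ⊕ neg c)) (odd (-1ℤ ⊖ j)) (+ 2 ⊛ neg b) (+ 2 ⊛ neg c)
        ≡⟨ cong₂ (λ e x → Φ e x (+ 2 ⊛ neg b) (+ 2 ⊛ neg c)) flipSign (negOdd j) ⟩
      Φ (sgn (i ⊕ c)) (neg (odd j)) (+ 2 ⊛ neg b) (+ 2 ⊛ neg c)
        ≡⟨ identity (sgn (i ⊕ c)) (odd i) (odd j) b c eq ⟩
      + 8 ⊛ (sgn (i ⊕ c) ⊛ (odd i ⊛ (k ⊖ + 2 ⊛ odd² i)))  ∎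
      where
      open ≡-Reasoning
      at : ℤ → ℤ → ℤ → ℤ → ℤ
      at e x y z = e ⊛ cubic k (odd i ⊕ x ⊕ y ⊕ z)
      -- The arguments are the four quantities altered by the flips, so that all eight terms are
      -- rewritten together.
      Φ : ℤ → ℤ → ℤ → ℤ → ℤ
      Φ e x y z = (at (sgn (i ⊕ c)) (odd j) (+ 2 ⊛ b) (+ 2 ⊛ c) ⊕ at (sgn (i ⊕ c)) x (+ 2 ⊛ b) (+ 2 ⊛ c)
                    ⊕ (at (sgn (i ⊕ c)) (odd j) y (+ 2 ⊛ c) ⊕ at (sgn (i ⊕ c)) x y (+ 2 ⊛ c)))
                ⊕ (at e (odd j) (+ 2 ⊛ b) z ⊕ at e x (+ 2 ⊛ b) z ⊕ (at e (odd j) y z ⊕ at e x y z))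
      flipSign : sgn (i ⊕ neg c) ≡ sgn (i ⊕ c)
      flipSign = trans (sym (sgn-shift (i ⊕ neg c) c)) (cong sgn (regroup i c))
        where
        regroup : ∀ i c → i ⊕ neg c ⊕ (c ⊕ c) ≡ i ⊕ c
        regroup = solve-∀
      identity : ∀ e u x b c {k} → u ⊛ u ⊕ (x ⊛ x ⊕ (+ 4 ⊛ (b ⊛ b) ⊕ + 4 ⊛ (c ⊛ c))) ≡ k →
        let at = λ x y z → e ⊛ ((u ⊕ x ⊕ y ⊕ z) ⊛ (u ⊕ x ⊕ y ⊕ z) ⊛ (u ⊕ x ⊕ y ⊕ z) ⊖ + 2 ⊛ k ⊛ (u ⊕ x ⊕ y ⊕ z)) in
          (at x (+ 2 ⊛ b) (+ 2 ⊛ c) ⊕ at (neg x) (+ 2 ⊛ b) (+ 2 ⊛ c)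
            ⊕ (at x (+ 2 ⊛ neg b) (+ 2 ⊛ c) ⊕ at (neg x) (+ 2 ⊛ neg b) (+ 2 ⊛ c)))
          ⊕ (at x (+ 2 ⊛ b) (+ 2 ⊛ neg c) ⊕ at (neg x) (+ 2 ⊛ b) (+ 2 ⊛ neg c)
            ⊕ (at x (+ 2 ⊛ neg b) (+ 2 ⊛ neg c) ⊕ at (neg x) (+ 2 ⊛ neg b) (+ 2 ⊛ neg c)))
        ≡ + 8 ⊛ (e ⊛ (u ⊛ (k ⊖ + 2 ⊛ (u ⊛ u))))
      identity e u x b c refl = expanded e u x b c
        where
        expanded : ∀ e u x b c →
          let k = u ⊛ u ⊕ (x ⊛ x ⊕ (+ 4 ⊛ (b ⊛ b) ⊕ + 4 ⊛ (c ⊛ c)))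
              at = λ x y z → e ⊛ ((u ⊕ x ⊕ y ⊕ z) ⊛ (u ⊕ x ⊕ y ⊕ z) ⊛ (u ⊕ x ⊕ y ⊕ z) ⊖ + 2 ⊛ k ⊛ (u ⊕ x ⊕ y ⊕ z)) in
            (at x (+ 2 ⊛ b) (+ 2 ⊛ c) ⊕ at (neg x) (+ 2 ⊛ b) (+ 2 ⊛ c)
              ⊕ (at x (+ 2 ⊛ neg b) (+ 2 ⊛ c) ⊕ at (neg x) (+ 2 ⊛ neg b) (+ 2 ⊛ c)))
            ⊕ (at x (+ 2 ⊛ b) (+ 2 ⊛ neg c) ⊕ at (neg x) (+ 2 ⊛ b) (+ 2 ⊛ neg c)
              ⊕ (at x (+ 2 ⊛ neg b) (+ 2 ⊛ neg c) ⊕ at (neg x) (+ 2 ⊛ neg b) (+ 2 ⊛ neg c)))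
          ≡ + 8 ⊛ (e ⊛ (u ⊛ (k ⊖ + 2 ⊛ (u ⊛ u))))
        expanded = solve-∀

  -- Each of the three sign changes permutes the level set, so adding the flipped summand doubles
  -- the sum.
  8∑-cubicSpread : + 8 ⊛ ∑ S cubicSpread ≡ + 8 ⊛ ∑ S derivative
  8∑-cubicSpread = begin
    + 8 ⊛ ∑ S cubicSpread                   ≡⟨ regroup (∑ S cubicSpread) ⟩
    + 2 ⊛ (+ 2 ⊛ (+ 2 ⊛ ∑ S cubicSpread))   ≡⟨ cong (λ x → + 2 ⊛ (+ 2 ⊛ x)) (∑-symmetrise flipOdd value-flipOdd flipOdd-involutive cubicSpread) ⟨
    + 2 ⊛ (+ 2 ⊛ ∑ S f₁)                    ≡⟨ cong (+ 2 ⊛_) (∑-symmetrise flipFst value-flipFst flipFst-involutive f₁) ⟨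
    + 2 ⊛ ∑ S f₂                            ≡⟨ ∑-symmetrise flipSnd value-flipSnd flipSnd-involutive f₂ ⟨
    ∑ S (symmetrise flipSnd f₂)             ≡⟨ ∑-cong S symmetrised ⟩
    ∑ S (λ v → + 8 ⊛ derivative v)          ≡⟨ ∑-* S (+ 8) derivative ⟩
    + 8 ⊛ ∑ S derivative                    ∎
    where
    open ≡-Reasoning
    f₁ = symmetrise flipOdd cubicSpread
    f₂ = symmetrise flipFst f₁
    regroup : ∀ x → + 8 ⊛ x ≡ + 2 ⊛ (+ 2 ⊛ (+ 2 ⊛ x))
    regroup = solve-∀
    value-flipFst : ∀ v → value quaternary v ≡ k → value quaternary (flipFst v) ≡ k
    value-flipFst (i , j , b , c) = trans (cong (λ z → odd² i ⊕ (odd² j ⊕ (+ 4 ⊛ z ⊕ + 4 ⊛ sq c))) (sq-neg b))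
    value-flipSnd : ∀ v → value quaternary v ≡ k → value quaternary (flipSnd v) ≡ k
    value-flipSnd (i , j , b , c) = trans (cong (λ z → odd² i ⊕ (odd² j ⊕ (+ 4 ⊛ sq b ⊕ + 4 ⊛ z))) (sq-neg c))
    flipFst-involutive : ∀ v → flipFst (flipFst v) ≡ v
    flipFst-involutive (i , j , b , c) = cong (λ z → i , j , z , c) (ℤₚ.neg-involutive b)
    flipSnd-involutive : ∀ v → flipSnd (flipSnd v) ≡ v
    flipSnd-involutive (i , j , b , c) = cong (λ z → i , j , b , z) (ℤₚ.neg-involutive c)

  -- Let X be this sum and D the sum of `cubicDouble` over `S⁺`. Summing `cubicSpread` over both
  -- halves gives X = D, up to the common factor 8; summing `cubicDouble` gives -4X = 2D. Together
  -- these force X = 0.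
  ∑-derivative : ∑ S (λ v@(i , _) → ε v ⊛ (odd i ⊛ (k ⊖ + 2 ⊛ odd² i))) ≡ 0ℤ
  ∑-derivative = ℤₚ.*-cancelˡ-≡ (+ 24) X 0ℤ (begin
    -- The multiple 24 combines 8X = 8D with four times -4X = 2D and avoids division.
    + 24 ⊛ X                              ≡⟨ regroup X ⟩
    + 8 ⊛ X ⊖ + 4 ⊛ (ℤ.- + 4 ⊛ X)         ≡⟨ cong₂ (λ a b → a ⊖ + 4 ⊛ b) (trans (sym 8∑-cubicSpread) (cong (+ 8 ⊛_) spreadSum)) doubleSum ⟩
    + 8 ⊛ D ⊖ + 4 ⊛ (D ⊕ D)               ≡⟨ cancel D ⟩
    0ℤ                                    ∎)
    where
    open ≡-Reasoning
    X = ∑ S derivative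
    D = ∑ S⁺ cubicDouble
    regroup : ∀ x → + 24 ⊛ x ≡ + 8 ⊛ x ⊖ + 4 ⊛ (ℤ.- + 4 ⊛ x)
    regroup = solve-∀
    cancel : ∀ d → + 8 ⊛ d ⊖ + 4 ⊛ (d ⊕ d) ≡ 0ℤ
    cancel = solve-∀
    spreadSum : ∑ S cubicSpread ≡ D
    spreadSum = trans (∑-split S (even? ∘ indexSum) cubicSpread)
      (trans (cong₂ _⊕_ ∑S⁺-cubicSpread ∑S⁻-cubicSpread) (ℤₚ.+-identityʳ D))
    doubleSum : ℤ.- + 4 ⊛ X ≡ D ⊕ D
    doubleSum = begin
      ℤ.- + 4 ⊛ X                           ≡⟨ ∑-* S (ℤ.- + 4) derivative ⟨
      ∑ S (λ v → ℤ.- + 4 ⊛ derivative v)    ≡⟨ ∑-cong S (λ v@(i , _) _ → expand (ε v) k (odd i)) ⟩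
      ∑ S cubicDouble                       ≡⟨ ∑-split S (even? ∘ indexSum) cubicDouble ⟩
      D ⊕ ∑ S⁻ cubicDouble                  ≡⟨ cong (D ⊕_) ∑S⁻-cubicDouble ⟩
      D ⊕ D                                 ∎
      where
      expand : ∀ e k u → ℤ.- + 4 ⊛ (e ⊛ (u ⊛ (k ⊖ + 2 ⊛ (u ⊛ u))))
        ≡ e ⊛ ((+ 2 ⊛ u) ⊛ (+ 2 ⊛ u) ⊛ (+ 2 ⊛ u) ⊖ + 2 ⊛ k ⊛ (+ 2 ⊛ u))
      expand = solve-∀

-- Jacobi's derivative formula

signedCount : ℤ → ℤ
signedCount k = ∑ (level ternary k) (λ (_ , _ , c) → sgn c)

oddRoot : Form ℤ
oddRoot = ⟨ odd²-coercive ⟩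

jacobiCoeff : ℤ → ℤ
jacobiCoeff k = ∑ (level oddRoot k) (λ i → sgn i ⊛ odd i)

-- Convolving a series f with this weight yields the coefficients of θ₁′ · D(f) - D(θ₁′) · f: the
-- slice at u carries χ₋₄(u) u times the difference (k - u²) - u² of the two exponents.
weight : ℤ → ℤ → ℤ
weight k i = sgn i ⊛ (odd i ⊛ (k ⊖ + 2 ⊛ odd² i))

-- The vanishing of `∑-derivative`, sliced by the first coordinate after splitting `ε` into (-1)^i
-- and (-1)^c.
convolve-signedCount : ∀ k → ∑ (interval ∣ k ∣) (λ i → weight k i ⊛ signedCount (k ⊖ odd² i)) ≡ 0ℤ
convolve-signedCount k = begin
  ∑ I (λ i → weight k i ⊛ signedCount (k ⊖ odd² i))
    ≡⟨ ∑-cong I (λ i _ → sym (∑-* (level ternary (k ⊖ odd² i)) (weight k i) _)) ⟩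
  ∑ I (λ i → ∑ (level ternary (k ⊖ odd² i)) (λ (_ , _ , c) → weight k i ⊛ sgn c))
    ≡⟨ ∑-⊞ odd²-coercive ternary k (λ (i , _ , _ , c) → weight k i ⊛ sgn c) ⟨
  ∑ (level quaternary k) (λ (i , _ , _ , c) → weight k i ⊛ sgn c)
    ≡⟨ ∑-cong (level quaternary k) (λ (i , _ , _ , c) _ →
         trans (regroup (sgn i) _ (sgn c)) (cong (_⊛ (odd i ⊛ (k ⊖ + 2 ⊛ odd² i))) (sym (sgn-+ i c)))) ⟩
  ∑ (level quaternary k) (λ v@(i , _) → ε v ⊛ (odd i ⊛ (k ⊖ + 2 ⊛ odd² i)))
    ≡⟨ ∑-derivative k ⟩
  0ℤ ∎
  where
  open ≡-Reasoning
  I = interval ∣ k ∣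
  regroup : ∀ a b c → a ⊛ b ⊛ c ≡ a ⊛ c ⊛ b
  regroup = solve-∀

-- For f = θ₁′ the expression is antisymmetric: on u² + v² = k the factor k - 2u² is v² - u², which
-- changes sign when u and v are exchanged.
convolve-jacobiCoeff : ∀ k → ∑ (interval ∣ k ∣) (λ i → weight k i ⊛ jacobiCoeff (k ⊖ odd² i)) ≡ 0ℤ
convolve-jacobiCoeff k = begin
  ∑ I (λ i → weight k i ⊛ jacobiCoeff (k ⊖ odd² i))
    ≡⟨ ∑-cong I (λ i _ → sym (∑-* (level oddRoot (k ⊖ odd² i)) (weight k i) _)) ⟩
  ∑ I (λ i → ∑ (level oddRoot (k ⊖ odd² i)) (λ j → weight k i ⊛ (sgn j ⊛ odd j)))
    ≡⟨ ∑-⊞ odd²-coercive oddRoot k f ⟨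
  ∑ E f
    ≡⟨ selfNeg (trans (∑-involution E (λ (i , j) → j , i) (λ (i , j) → trans (ℤₚ.+-comm (odd² j) (odd² i)))
         (λ _ _ → refl) f (λ v → -1ℤ ⊛ f v) antisym) (∑-* E -1ℤ f)) ⟩
  0ℤ ∎
  where
  open ≡-Reasoning
  I = interval ∣ k ∣
  E = level (odd²-coercive ⊞ oddRoot) k
  f : ℤ × ℤ → ℤ
  f (i , j) = weight k i ⊛ (sgn j ⊛ odd j)
  antisym : ∀ v → odd² (proj₁ v) ⊕ odd² (proj₂ v) ≡ k → f v ≡ -1ℤ ⊛ f (proj₂ v , proj₁ v)
  antisym (i , j) eq = identity (sgn i) (sgn j) (odd i) (odd j) eq
    where
    identity : ∀ d e x y {k} → x ⊛ x ⊕ y ⊛ y ≡ k →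
      d ⊛ (x ⊛ (k ⊖ + 2 ⊛ (x ⊛ x))) ⊛ (e ⊛ y) ≡ -1ℤ ⊛ (e ⊛ (y ⊛ (k ⊖ + 2 ⊛ (y ⊛ y))) ⊛ (d ⊛ x))
    identity d e x y refl = expanded d e x y
      where
      expanded : ∀ d e x y →
        d ⊛ (x ⊛ (x ⊛ x ⊕ y ⊛ y ⊖ + 2 ⊛ (x ⊛ x))) ⊛ (e ⊛ y) ≡ -1ℤ ⊛ (e ⊛ (y ⊛ (x ⊛ x ⊕ y ⊛ y ⊖ + 2 ⊛ (y ⊛ y))) ⊛ (d ⊛ x))
      expanded = solve-∀

discrepancy : ℤ → ℤ
discrepancy k = signedCount k ⊖ jacobiCoeff k

convolve-discrepancy : ∀ k → ∑ (interval ∣ k ∣) (λ i → weight k i ⊛ discrepancy (k ⊖ odd² i)) ≡ 0ℤ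
convolve-discrepancy k = begin
  ∑ I (λ i → weight k i ⊛ discrepancy (k ⊖ odd² i))
    ≡⟨ ∑-cong I {g = λ i → p i ⊕ -1ℤ ⊛ j i} (λ i _ → distribute (weight k i) (signedCount (k ⊖ odd² i)) (jacobiCoeff (k ⊖ odd² i))) ⟩
  ∑ I (λ i → p i ⊕ -1ℤ ⊛ j i)          ≡⟨ ∑-+ I p (λ i → -1ℤ ⊛ j i) ⟩
  ∑ I p ⊕ ∑ I (λ i → -1ℤ ⊛ j i)        ≡⟨ cong (∑ I p ⊕_) (∑-* I -1ℤ j) ⟩
  ∑ I p ⊕ -1ℤ ⊛ ∑ I j                  ≡⟨ cong₂ (λ x y → x ⊕ -1ℤ ⊛ y) (convolve-signedCount k) (convolve-jacobiCoeff k) ⟩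
  0ℤ                                   ∎
  where
  open ≡-Reasoning
  I = interval ∣ k ∣
  p j : ℤ → ℤ
  p i = weight k i ⊛ signedCount (k ⊖ odd² i)
  j i = weight k i ⊛ jacobiCoeff (k ⊖ odd² i)
  distribute : ∀ w a b → w ⊛ (a ⊖ b) ≡ w ⊛ a ⊕ -1ℤ ⊛ (w ⊛ b)
  distribute = solve-∀

level-negative : {A : Set} (F : Form A) → ∀ n f → ∑ (level F -[1+ n ]) f ≡ 0ℤ
level-negative F n f = ∑-0 (level F -[1+ n ]) (λ a eq → ⊥-elim (absurd (subst (0ℤ ℤ.≤_) eq (nonneg F a))))
  where
  absurd : ¬ 0ℤ ℤ.≤ -[1+ n ]
  absurd ()

discrepancy-negative : ∀ n → discrepancy -[1+ n ] ≡ 0ℤ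
discrepancy-negative n = cong₂ _⊖_ (level-negative ternary n _) (level-negative oddRoot n _)

odd²≡1 : ∀ i → odd² i ≡ 1ℤ → i ≡ 0ℤ ⊎ i ≡ -1ℤ
odd²≡1 i eq with ℤₚ.i*j≡0⇒i≡0∨j≡0 i {i ⊕ 1ℤ} product
  where
  factor : ∀ i → + 4 ⊛ (i ⊛ (i ⊕ 1ℤ)) ≡ (+ 2 ⊛ i ⊕ 1ℤ) ⊛ (+ 2 ⊛ i ⊕ 1ℤ) ⊖ 1ℤ
  factor = solve-∀
  product : i ⊛ (i ⊕ 1ℤ) ≡ 0ℤ
  product = ℤₚ.*-cancelˡ-≡ (+ 4) (i ⊛ (i ⊕ 1ℤ)) 0ℤ (trans (factor i) (cong (_⊖ 1ℤ) eq))
... | inj₁ i≡0 = inj₁ i≡0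
... | inj₂ i+1≡0 = inj₂ (trans (sym (cancel i)) (cong (_⊖ 1ℤ) i+1≡0))
  where
  cancel : ∀ i → i ⊕ 1ℤ ⊖ 1ℤ ≡ i
  cancel = solve-∀

odd²≢0 : ∀ i → odd² i ≢ 0ℤ
odd²≢0 i eq = even≢odd {neg i} {0ℤ} (trans (sym (ℤₚ.+-identityʳ _)) (trans (cong (λ z → neg i ⊕ neg i ⊕ z) (sym oddZero)) (cancel i)))
  where
  oddZero : odd i ≡ 0ℤ
  oddZero = [ id , id ]′ (ℤₚ.i*j≡0⇒i≡0∨j≡0 (odd i) eq)
  cancel : ∀ i → neg i ⊕ neg i ⊕ (+ 2 ⊛ i ⊕ 1ℤ) ≡ 1ℤ
  cancel = solve-∀

-- The bound 2 is all that the recursion asks for: it puts k + 1 - u² strictly below k.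
odd²≥2 : ∀ i → odd² i ≢ 1ℤ → ∃ λ n → odd² i ≡ + suc (suc n)
odd²≥2 i ≢1 with odd² i | odd²≢0 i | coercive-nonneg odd²-coercive i
... | + zero          | ≢0 | _ = ⊥-elim (≢0 refl)
... | + suc zero      | _  | _ = ⊥-elim (≢1 refl)
... | + suc (suc n)   | _  | _ = n , refl

-- Strong induction through the convolution at k + 1. The roots u = 1 and u = -1 each contribute k -
-- 1 times the discrepancy at k; every other u reaches a smaller or negative index, where the
-- discrepancy is zero. Hence 2(k - 1) times the discrepancy at k vanishes.
discrepancy-vanishes : ∀ k → discrepancy (+ k) ≡ 0ℤ
discrepancy-vanishes = <-rec (λ k → discrepancy (+ k) ≡ 0ℤ) step
  where
  step : ∀ k → (∀ {j} → j ℕ.< k → discrepancy (+ j) ≡ 0ℤ) → discrepancy (+ k) ≡ 0ℤ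
  step k ih with k ℕ.≟ 1
  -- The factor k - 1 vanishes here. Evaluation gives 2 for both coefficients, which fixes the
  -- constant of proportionality between the two series.
  ... | yes refl = refl
  ... | no  k≢1  = [ (λ eq → ⊥-elim (k≢1 (toOne eq))) , id ]′
                     (ℤₚ.i*j≡0⇒i≡0∨j≡0 (+ 2 ⊛ (+ suc k ⊖ + 2)) isolated)
    where
    open ≡-Reasoning
    I = interval (suc k)
    unit? : Decidable (λ i → odd² i ≡ 1ℤ)
    unit? i = odd² i ℤ.≟ 1ℤ
    f : ℤ → ℤ
    f i = weight (+ suc k) i ⊛ discrepancy (+ suc k ⊖ odd² i)

    units : Enum (λ i → ∣ i ∣ ℕ.≤ suc k × odd² i ≡ 1ℤ)
    units = record
      { list     = 0ℤ ∷ -1ℤ ∷ []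
      ; unique   = ((λ ()) ∷ []) ∷ [] ∷ []
      ; sound    = λ { (here refl) → ℕ.z≤n , refl ; (there (here refl)) → ℕ.s≤s ℕ.z≤n , refl }
      ; complete = λ {i} (_ , eq) → [ here , there ∘ here ]′ (odd²≡1 i eq)
      }

    smaller : ∀ n → discrepancy (+ suc k ⊖ + suc (suc n)) ≡ 0ℤ
    smaller n with + suc k ⊖ + suc (suc n) | below
      where
      below : + suc k ⊖ + suc (suc n) ℤ.< + k
      below = subst (ℤ._< + k) (sym (shift (+ k) (+ n))) (ℤₚ.≤-<-trans (ℤₚ.≤-reflexive (ℤₚ.m-n≡m⊖n k (suc n))) (ℤₚ.m⊖1+n<m k (suc n)))
        where
        shift : ∀ k n → 1ℤ ⊕ k ⊖ (+ 2 ⊕ n) ≡ k ⊖ (1ℤ ⊕ n)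
        shift = solve-∀
    ... | + j      | ℤ.+<+ j<k = ih j<k
    ... | -[1+ j ] | _         = discrepancy-negative j

    rest : ∀ i → ∣ i ∣ ℕ.≤ suc k × odd² i ≢ 1ℤ → f i ≡ 0ℤ
    rest i (_ , ≢1) with n , eq ← odd²≥2 i ≢1 = begin
      weight (+ suc k) i ⊛ discrepancy (+ suc k ⊖ odd² i)            ≡⟨ cong (λ z → weight (+ suc k) i ⊛ discrepancy (+ suc k ⊖ z)) eq ⟩
      weight (+ suc k) i ⊛ discrepancy (+ suc k ⊖ + suc (suc n))     ≡⟨ cong (weight (+ suc k) i ⊛_) (smaller n) ⟩
      weight (+ suc k) i ⊛ 0ℤ                                        ≡⟨ ℤₚ.*-zeroʳ (weight (+ suc k) i) ⟩
      0ℤ                                                             ∎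

    isolated : + 2 ⊛ (+ suc k ⊖ + 2) ⊛ discrepancy (+ k) ≡ 0ℤ
    isolated = begin
      + 2 ⊛ (+ suc k ⊖ + 2) ⊛ discrepancy (+ k)
        ≡⟨ collect (+ suc k ⊖ + 2) (discrepancy (+ k)) ⟩
      ∑ units f
        ≡⟨ ∑-unique units (restrict I unit?) f ⟩
      ∑ (restrict I unit?) f
        ≡⟨ ℤₚ.+-identityʳ _ ⟨
      ∑ (restrict I unit?) f ⊕ 0ℤ
        ≡⟨ cong (∑ (restrict I unit?) f ⊕_) (∑-0 (restrict I (¬? ∘ unit?)) rest) ⟨
      ∑ (restrict I unit?) f ⊕ ∑ (restrict I (¬? ∘ unit?)) f
        ≡⟨ ∑-split I unit? f ⟨
      ∑ I f
        ≡⟨ convolve-discrepancy (+ suc k) ⟩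
      0ℤ ∎
      where
      collect : ∀ a d → + 2 ⊛ a ⊛ d ≡ 1ℤ ⊛ (1ℤ ⊛ a) ⊛ d ⊕ (-1ℤ ⊛ (-1ℤ ⊛ a) ⊛ d ⊕ 0ℤ)
      collect = solve-∀

    toOne : + 2 ⊛ (+ suc k ⊖ + 2) ≡ 0ℤ → k ≡ 1
    toOne eq = ℤₚ.+-injective (trans (shift (+ k)) (cong (_⊕ 1ℤ)
      (ℤₚ.*-cancelˡ-≡ (+ 2) (+ suc k ⊖ + 2) 0ℤ eq)))
      where
      shift : ∀ k → k ≡ 1ℤ ⊕ k ⊖ + 2 ⊕ 1ℤ
      shift = solve-∀

signedCount≡jacobiCoeff : ∀ k → signedCount k ≡ jacobiCoeff k
signedCount≡jacobiCoeff k = ℤₚ.i-j≡0⇒i≡j (signedCount k) (jacobiCoeff k) (vanishes k)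
  where
  vanishes : ∀ k → discrepancy k ≡ 0ℤ
  vanishes (+ n)    = discrepancy-vanishes n
  vanishes -[1+ n ] = discrepancy-negative n

signedCount-nonsquare : ∀ k → (∀ i → odd² i ≢ k) → signedCount k ≡ 0ℤ
signedCount-nonsquare k nonsquare =
  trans (signedCount≡jacobiCoeff k) (∑-0 (level oddRoot k) (λ i eq → ⊥-elim (nonsquare i eq)))

-- The form x² + y² + 8z² at twice a number that is not an odd square

8sq-coercive : Coercive (λ x → + 8 ⊛ sq x)
8sq-coercive = scale-coercive 7 sq-coercive

oddPair : Form (ℤ × ℤ × ℤ)
oddPair = odd²-coercive ⊞ odd²-coercive ⊞ ⟨ 8sq-coercive ⟩

-- When X ≡ Y modulo 4, writing X and Y as (2u + 1) ± 2b turns the form into twice `ternary` without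
-- moving z, so this half gives `signedCount q`. Negating Y carries the other half onto it.
∑-oddPair : ∀ q → (∀ i → odd² i ≢ q) → ∑ (level oddPair (q ⊕ q)) (λ (_ , _ , z) → sgn z) ≡ 0ℤ
∑-oddPair q nonsquare = begin
  ∑ E s              ≡⟨ ∑-split E (even? ∘ difference) s ⟩
  ∑ E⁺ s ⊕ ∑ E⁻ s    ≡⟨ cong₂ _⊕_ E⁺-vanishes (trans E⁻≡E⁺ E⁺-vanishes) ⟩
  0ℤ                 ∎
  where
  open ≡-Reasoning
  s difference : ℤ × ℤ × ℤ → ℤ
  s (_ , _ , z) = sgn z
  difference (i , j , _) = i ⊖ j
  E  = level oddPair (q ⊕ q)
  E⁺ = restrict E (even? ∘ difference)
  E⁻ = restrict E (¬? ∘ even? ∘ difference)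

  rotated : ∀ u b z → value oddPair (u ⊕ b , u ⊖ b , z) ≡ value ternary (u , b , z) ⊕ value ternary (u , b , z)
  rotated = identity
    where
    identity : ∀ u b z →
      (+ 2 ⊛ (u ⊕ b) ⊕ 1ℤ) ⊛ (+ 2 ⊛ (u ⊕ b) ⊕ 1ℤ) ⊕ ((+ 2 ⊛ (u ⊖ b) ⊕ 1ℤ) ⊛ (+ 2 ⊛ (u ⊖ b) ⊕ 1ℤ) ⊕ + 8 ⊛ (z ⊛ z))
      ≡ (+ 2 ⊛ u ⊕ 1ℤ) ⊛ (+ 2 ⊛ u ⊕ 1ℤ) ⊕ (+ 4 ⊛ (b ⊛ b) ⊕ + 4 ⊛ (z ⊛ z))
        ⊕ ((+ 2 ⊛ u ⊕ 1ℤ) ⊛ (+ 2 ⊛ u ⊕ 1ℤ) ⊕ (+ 4 ⊛ (b ⊛ b) ⊕ + 4 ⊛ (z ⊛ z)))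
    identity = solve-∀

  rotate unrotate : ℤ × ℤ × ℤ → ℤ × ℤ × ℤ
  rotate (i , j , z) = j ⊕ half (i ⊖ j) , half (i ⊖ j) , z
  unrotate (u , b , z) = u ⊕ b , u ⊖ b , z

  gap : ∀ u b → u ⊕ b ⊖ (u ⊖ b) ≡ b ⊕ b
  gap = solve-∀

  unrotate-rotate : ∀ v → Even (difference v) → unrotate (rotate v) ≡ v
  unrotate-rotate (i , j , z) ev = cong₂ _,_ (trans (ℤₚ.+-assoc j _ _) (trans (cong (j ⊕_) (sym ev)) (cancel i j)))
                                             (cong (_, z) (cancel′ j (half (i ⊖ j))))
    where
    cancel : ∀ i j → j ⊕ (i ⊖ j) ≡ i
    cancel = solve-∀
    cancel′ : ∀ j b → j ⊕ b ⊖ b ≡ j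
    cancel′ = solve-∀

  E⁺-vanishes : ∑ E⁺ s ≡ 0ℤ
  E⁺-vanishes = trans
    (∑-reindex E⁺ (level ternary q) rotate unrotate
      (λ v@(i , j , z) (eq , ev) → double-injective (trans (sym (rotated (j ⊕ half (i ⊖ j)) (half (i ⊖ j)) z))
                                     (trans (cong (value oddPair) (unrotate-rotate v ev)) eq)))
      (λ (u , b , z) eq → trans (rotated u b z) (cong₂ _⊕_ eq eq) , double-even b (gap u b))
      (λ v (_ , ev) → unrotate-rotate v ev)
      (λ (u , b , z) _ → trans (cong (λ h → u ⊖ b ⊕ h , h , z) (trans (cong half (gap u b)) (half-double b)))
                               (cong (_, b , z) (cancel u b)))
      s s (λ _ _ → refl))
    (signedCount-nonsquare q nonsquare)
    where
    cancel : ∀ u b → u ⊖ b ⊕ b ≡ u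
    cancel = solve-∀

  flip : ℤ × ℤ × ℤ → ℤ × ℤ × ℤ
  flip (i , j , z) = i , -1ℤ ⊖ j , z

  value-flip : ∀ v → value oddPair v ≡ q ⊕ q → value oddPair (flip v) ≡ q ⊕ q
  value-flip (i , j , z) = trans (cong (λ x → odd² i ⊕ (x ⊕ + 8 ⊛ sq z)) (odd²-negOdd j))

  flip-involutive : ∀ v → flip (flip v) ≡ v
  flip-involutive (i , j , z) = cong (λ x → i , x , z) (negOdd-involutive j)

  difference-flip : ∀ i j → i ⊖ (-1ℤ ⊖ j) ≡ (i ⊖ j) ⊕ (1ℤ ⊕ (j ⊕ j))
  difference-flip = solve-∀

  E⁻≡E⁺ : ∑ E⁻ s ≡ ∑ E⁺ s
  E⁻≡E⁺ = ∑-reindex E⁻ E⁺ flip flip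
    (λ v@(i , j , _) (eq , ne) → value-flip v eq , toEven i j (not-even ne))
    (λ v@(i , j , _) (eq , ev) → value-flip v eq , toOdd i j ev)
    (λ v _ → flip-involutive v) (λ v _ → flip-involutive v) s s (λ _ _ → refl)
    where
    toEven : ∀ i j → (∃ λ h → i ⊖ j ≡ 1ℤ ⊕ (h ⊕ h)) → Even (i ⊖ (-1ℤ ⊖ j))
    toEven i j (h , eq) = double-even (1ℤ ⊕ h ⊕ j)
      (trans (difference-flip i j) (trans (cong (_⊕ (1ℤ ⊕ (j ⊕ j))) eq) (regroup h j)))
      where
      regroup : ∀ h j → 1ℤ ⊕ (h ⊕ h) ⊕ (1ℤ ⊕ (j ⊕ j)) ≡ 1ℤ ⊕ h ⊕ j ⊕ (1ℤ ⊕ h ⊕ j)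
      regroup = solve-∀
    toOdd : ∀ i j → Even (i ⊖ j) → ¬ Even (i ⊖ (-1ℤ ⊖ j))
    toOdd i j ev = odd-not-even (half (i ⊖ j) ⊕ j)
      (trans (difference-flip i j) (trans (cong (_⊕ (1ℤ ⊕ (j ⊕ j))) ev) (regroup (half (i ⊖ j)) j)))
      where
      regroup : ∀ h j → h ⊕ h ⊕ (1ℤ ⊕ (j ⊕ j)) ≡ 1ℤ ⊕ (h ⊕ j ⊕ (h ⊕ j))
      regroup = solve-∀

-- The coefficient is m + 1, so that it is positive.
oddTriple : ℕ → Form (ℤ × ℤ × ℤ × ℤ)
oddTriple m = scale-coercive m odd²-coercive ⊞ oddPair

-- Fixing W = 2l + 1 leaves 2q, with q equal to 4n + 5 minus 2(l² + l) times the coefficient of W²,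
-- and each slice is an instance of `∑-oddPair`.
∑-oddTriple : ∀ m n → (∀ l i → odd² i ≢ + (4 ℕ.* n ℕ.+ 5) ⊖ + suc m ⊛ (+ 2 ⊛ (l ⊛ l ⊕ l))) →
  ∑ (level (oddTriple m) (+ (8 ℕ.* n ℕ.+ 10 ℕ.+ suc m))) (λ (_ , _ , _ , z) → sgn z) ≡ 0ℤ
∑-oddTriple m n nonsquare = trans (∑-⊞ (scale-coercive m odd²-coercive) oddPair k (λ (_ , _ , _ , z) → sgn z))
  (∑-0 (interval ∣ k ∣) (λ l _ → trans
    (cong (λ c → ∑ (level oddPair c) (λ (_ , _ , z) → sgn z)) (remainder l))
    (∑-oddPair (q l) (nonsquare l))))
  where
  k = + (8 ℕ.* n ℕ.+ 10 ℕ.+ suc m)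
  q : ℤ → ℤ
  q l = + (4 ℕ.* n ℕ.+ 5) ⊖ + suc m ⊛ (+ 2 ⊛ (l ⊛ l ⊕ l))
  remainder : ∀ l → k ⊖ + suc m ⊛ odd² l ≡ q l ⊕ q l
  remainder l = trans (cong (λ c → c ⊕ + 10 ⊕ + suc m ⊖ + suc m ⊛ odd² l) (ℤₚ.pos-* 8 n))
    (trans (expand (+ n) (+ suc m) l) (cong (λ c → double (c ⊕ + 5)) (sym (ℤₚ.pos-* 4 n))))
    where
    double : ℤ → ℤ
    double c = c ⊖ + suc m ⊛ (+ 2 ⊛ (l ⊛ l ⊕ l)) ⊕ (c ⊖ + suc m ⊛ (+ 2 ⊛ (l ⊛ l ⊕ l)))
    expand : ∀ n m l → + 8 ⊛ n ⊕ + 10 ⊕ m ⊖ m ⊛ ((+ 2 ⊛ l ⊕ 1ℤ) ⊛ (+ 2 ⊛ l ⊕ 1ℤ))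
      ≡ + 4 ⊛ n ⊕ + 5 ⊖ m ⊛ (+ 2 ⊛ (l ⊛ l ⊕ l)) ⊕ (+ 4 ⊛ n ⊕ + 5 ⊖ m ⊛ (+ 2 ⊛ (l ⊛ l ⊕ l)))
    expand = solve-∀

-- Nonresidues

-- The value -1 arises only in the branch where the search for a root among all residues has failed.
legendre-nonresidue : ∀ a p → legendre (+ a) (suc p) ≡ -[1+ 0 ] → ∀ x → x ℕ.< suc p → x ℕ.* x ℕ.% suc p ≢ a ℕ.% suc p
legendre-nonresidue a p eq x x<p x²≡a with (+ a) ℤ.%ℕ suc p ℕ.≟ 0
... | yes _ with () ← eq
... | no _ with any? (λ x → (x ℕ.* x) ℕ.% suc p ℕ.≟ ((+ a) ℤ.%ℕ suc p)) (upTo (suc p))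
...   | yes _ with () ← eq
...   | no none = none (lose (∈-upTo⁺ x<p) x²≡a)

-- The multiple of the modulus is moved to the side where it is nonnegative, so that the remainder
-- laws for natural numbers apply.
≡-mod : ∀ a b p y → + a ≡ + b ⊖ + suc p ⊛ y → a ℕ.% suc p ≡ b ℕ.% suc p
≡-mod a b p (+ y) eq = trans (sym (DM.[m+kn]%n≡m%n a y (suc p))) (cong (ℕ._% suc p) (ℤₚ.+-injective (begin
  + a ⊕ + (y ℕ.* suc p)              ≡⟨ cong₂ _⊕_ eq (trans (ℤₚ.pos-* y (suc p)) (ℤₚ.*-comm (+ y) (+ suc p))) ⟩
  + b ⊖ + suc p ⊛ + y ⊕ + suc p ⊛ + y  ≡⟨ cancel (+ b) (+ suc p ⊛ + y) ⟩
  + b                                ∎)))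
  where
  open ≡-Reasoning
  cancel : ∀ b z → b ⊖ z ⊕ z ≡ b
  cancel = solve-∀
≡-mod a b p -[1+ y ] eq = trans (cong (ℕ._% suc p) (ℤₚ.+-injective (begin
  + a                          ≡⟨ eq ⟩
  + b ⊖ + suc p ⊛ neg (+ suc y)  ≡⟨ flipSign (+ b) (+ suc p) (+ suc y) ⟩
  + b ⊕ + suc y ⊛ + suc p      ≡⟨ cong (+ b ⊕_) (ℤₚ.pos-* (suc y) (suc p)) ⟨
  + (b ℕ.+ suc y ℕ.* suc p)    ∎))) (DM.[m+kn]%n≡m%n b (suc y) (suc p))
  where
  open ≡-Reasoning
  flipSign : ∀ b p y → b ⊖ p ⊛ neg y ≡ b ⊕ y ⊛ p
  flipSign = solve-∀

sq-abs : ∀ x → sq x ≡ + (∣ x ∣ ℕ.* ∣ x ∣)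
sq-abs (+ n)    = sym (ℤₚ.pos-* n n)
sq-abs -[1+ n ] = refl

nonresidue-nonsquare : ∀ a p → legendre (+ a) (suc p) ≡ -[1+ 0 ] → ∀ x y → sq x ≢ + a ⊖ + suc p ⊛ y
nonresidue-nonsquare a p leg x y eq = legendre-nonresidue a p leg r (DM.m%n<n ∣ x ∣ (suc p))
  (trans (sym (DM.%-distribˡ-* ∣ x ∣ ∣ x ∣ (suc p))) (≡-mod (∣ x ∣ ℕ.* ∣ x ∣) a p y (trans (sym (sq-abs x)) eq)))
  where r = ∣ x ∣ ℕ.% suc p

-- Parities of the solutions

oddIndex : ℤ → ℤ
oddIndex x = half (x ⊖ 1ℤ)

odd-oddIndex : ∀ {x} → ¬ Even x → odd (oddIndex x) ≡ x
odd-oddIndex {x} ne with h , refl ← not-even ne =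
  trans (cong odd (trans (cong half (cancel h)) (half-double h))) (expand h)
  where
  cancel : ∀ h → 1ℤ ⊕ (h ⊕ h) ⊖ 1ℤ ≡ h ⊕ h
  cancel = solve-∀
  expand : ∀ h → + 2 ⊛ h ⊕ 1ℤ ≡ 1ℤ ⊕ (h ⊕ h)
  expand = solve-∀

oddIndex-odd : ∀ i → oddIndex (odd i) ≡ i
oddIndex-odd i = trans (cong half (cancel i)) (half-double i)
  where
  cancel : ∀ i → + 2 ⊛ i ⊕ 1ℤ ⊖ 1ℤ ≡ i ⊕ i
  cancel = solve-∀

odd-odd : ∀ i → ¬ Even (odd i)
odd-odd i = odd-not-even i (expand i)
  where
  expand : ∀ i → + 2 ⊛ i ⊕ 1ℤ ≡ 1ℤ ⊕ (i ⊕ i)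
  expand = solve-∀

consecutive-even : ∀ x → ∃ λ t → x ⊛ (x ⊖ 1ℤ) ≡ t ⊛ + 2
consecutive-even x with parity x
... | h , inj₁ refl = h ⊛ (h ⊕ h ⊖ 1ℤ) , expand h
  where
  expand : ∀ h → (h ⊕ h) ⊛ (h ⊕ h ⊖ 1ℤ) ≡ h ⊛ (h ⊕ h ⊖ 1ℤ) ⊛ + 2
  expand = solve-∀
... | h , inj₂ refl = (1ℤ ⊕ (h ⊕ h)) ⊛ h , expand h
  where
  expand : ∀ h → (1ℤ ⊕ (h ⊕ h)) ⊛ (1ℤ ⊕ (h ⊕ h) ⊖ 1ℤ) ≡ (1ℤ ⊕ (h ⊕ h)) ⊛ h ⊛ + 2
  expand = solve-∀

odd-square-mod-8 : ∀ {x} → ¬ Even x → ∃ λ t → sq x ≡ t ⊛ + 8 ⊕ 1ℤ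
odd-square-mod-8 {x} ne with h , refl ← not-even ne with t , eq ← consecutive-even (1ℤ ⊕ h) = t , (begin
  (1ℤ ⊕ (h ⊕ h)) ⊛ (1ℤ ⊕ (h ⊕ h))          ≡⟨ expand h ⟩
  + 4 ⊛ ((1ℤ ⊕ h) ⊛ (1ℤ ⊕ h ⊖ 1ℤ)) ⊕ 1ℤ    ≡⟨ cong (λ z → + 4 ⊛ z ⊕ 1ℤ) eq ⟩
  + 4 ⊛ (t ⊛ + 2) ⊕ 1ℤ                     ≡⟨ regroup t ⟩
  t ⊛ + 8 ⊕ 1ℤ                             ∎)
  where
  open ≡-Reasoning
  expand : ∀ h → (1ℤ ⊕ (h ⊕ h)) ⊛ (1ℤ ⊕ (h ⊕ h)) ≡ + 4 ⊛ ((1ℤ ⊕ h) ⊛ (1ℤ ⊕ h ⊖ 1ℤ)) ⊕ 1ℤ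
  expand = solve-∀
  regroup : ∀ t → + 4 ⊛ (t ⊛ + 2) ⊕ 1ℤ ≡ t ⊛ + 8 ⊕ 1ℤ
  regroup = solve-∀

bit : Bool → ℤ
bit false = 0ℤ
bit true  = 1ℤ

-- The residue is recorded as a Boolean, which reduces congruences between several squares to a
-- finite table.
square-mod-4 : ∀ x → ∃ λ t → ∃ λ δ → sq x ≡ t ⊛ + 4 ⊕ bit δ × (δ ≡ true → ¬ Even x)
square-mod-4 x with even? x
... | yes ev = half x ⊛ half x , false , trans (cong sq ev) (expand (half x)) , λ ()
  where
  expand : ∀ h → (h ⊕ h) ⊛ (h ⊕ h) ≡ h ⊛ h ⊛ + 4 ⊕ 0ℤ
  expand = solve-∀
... | no ne with h , eq ← not-even ne = h ⊛ h ⊕ h , true , trans (cong sq eq) (expand h) , λ _ → ne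
  where
  expand : ∀ h → (1ℤ ⊕ (h ⊕ h)) ⊛ (1ℤ ⊕ (h ⊕ h)) ≡ (h ⊛ h ⊕ h) ⊛ + 4 ⊕ 1ℤ
  expand = solve-∀

-- Reduction modulo d with an explicit quotient `T`: the congruences below become identities for the
-- ring solver.
remainder-divisible : ∀ d {L R} T c → L ≡ R → L ⊖ R ≡ T ⊛ + d ⊕ c → d ∣ ∣ c ∣
remainder-divisible d {L} T c refl eq = divides ∣ neg T ∣ (trans (cong ∣_∣ solved) (ℤₚ.abs-* (neg T) (+ d)))
  where
  isolate : ∀ T d c → c ≡ T ⊛ d ⊕ c ⊕ neg T ⊛ d
  isolate = solve-∀
  solved : c ≡ neg T ⊛ + d
  solved = trans (isolate T (+ d) c)
    (trans (cong (_⊕ neg T ⊛ + d) (trans (sym eq) (ℤₚ.+-inverseʳ L))) (ℤₚ.+-identityˡ (neg T ⊛ + d)))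

-- The capital letters stand for the squares of the variables in a representation of 8n + 10 + m.
Balanced : (X Y Z W m n : ℤ) → Set
Balanced X Y Z W m n = X ⊕ (Y ⊕ (+ 8 ⊛ Z ⊕ m ⊛ W)) ≡ + 8 ⊛ n ⊕ + 10 ⊕ m

-- Modulo 4 the left side is X + Y + W and the right side is 2 + 1.
balanced-1-mod-4 : ∀ p q z r a n δ η θ →
  Balanced (p ⊛ + 4 ⊕ δ) (q ⊛ + 4 ⊕ η) z (r ⊛ + 4 ⊕ θ) (a ⊛ + 4 ⊕ 1ℤ) n → 4 ∣ ∣ δ ⊕ η ⊕ θ ⊖ + 3 ∣
balanced-1-mod-4 p q z r a n δ η θ eq = remainder-divisible 4
  (p ⊕ q ⊕ + 2 ⊛ z ⊕ a ⊛ (r ⊛ + 4 ⊕ θ) ⊕ r ⊖ + 2 ⊛ n ⊖ + 2 ⊖ a) (δ ⊕ η ⊕ θ ⊖ + 3) eq (identity p q z r a n δ η θ)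
  where
  identity : ∀ p q z r a n δ η θ →
    p ⊛ + 4 ⊕ δ ⊕ (q ⊛ + 4 ⊕ η ⊕ (+ 8 ⊛ z ⊕ (a ⊛ + 4 ⊕ 1ℤ) ⊛ (r ⊛ + 4 ⊕ θ))) ⊖ (+ 8 ⊛ n ⊕ + 10 ⊕ (a ⊛ + 4 ⊕ 1ℤ))
    ≡ (p ⊕ q ⊕ + 2 ⊛ z ⊕ a ⊛ (r ⊛ + 4 ⊕ θ) ⊕ r ⊖ + 2 ⊛ n ⊖ + 2 ⊖ a) ⊛ + 4 ⊕ (δ ⊕ η ⊕ θ ⊖ + 3)
  identity = solve-∀

-- Modulo 4 both terms with m disappear, leaving X + Y ≡ 2.
balanced-4-mod-8 : ∀ p q z W a n δ η →
  Balanced (p ⊛ + 4 ⊕ δ) (q ⊛ + 4 ⊕ η) z W (a ⊛ + 8 ⊕ + 4) n → 4 ∣ ∣ δ ⊕ η ⊖ + 2 ∣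
balanced-4-mod-8 p q z W a n δ η eq = remainder-divisible 4
  (p ⊕ q ⊕ + 2 ⊛ z ⊕ (a ⊛ + 2 ⊕ 1ℤ) ⊛ W ⊖ + 2 ⊛ n ⊖ + 3 ⊖ a ⊛ + 2) (δ ⊕ η ⊖ + 2) eq (identity p q z W a n δ η)
  where
  identity : ∀ p q z W a n δ η →
    p ⊛ + 4 ⊕ δ ⊕ (q ⊛ + 4 ⊕ η ⊕ (+ 8 ⊛ z ⊕ (a ⊛ + 8 ⊕ + 4) ⊛ W)) ⊖ (+ 8 ⊛ n ⊕ + 10 ⊕ (a ⊛ + 8 ⊕ + 4))
    ≡ (p ⊕ q ⊕ + 2 ⊛ z ⊕ (a ⊛ + 2 ⊕ 1ℤ) ⊛ W ⊖ + 2 ⊛ n ⊖ + 3 ⊖ a ⊛ + 2) ⊛ + 4 ⊕ (δ ⊕ η ⊖ + 2)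
  identity = solve-∀

-- A second pass, once X and Y are known to be 1 modulo 8: now 2 + 4W ≡ 14 modulo 8 determines the
-- parity of W.
balanced-4-mod-8′ : ∀ p q z r a n θ →
  Balanced (p ⊛ + 8 ⊕ 1ℤ) (q ⊛ + 8 ⊕ 1ℤ) z (r ⊛ + 4 ⊕ θ) (a ⊛ + 8 ⊕ + 4) n → 8 ∣ ∣ + 4 ⊛ θ ⊖ + 4 ∣
balanced-4-mod-8′ p q z r a n θ eq = remainder-divisible 8
  (p ⊕ q ⊕ z ⊕ a ⊛ (r ⊛ + 4 ⊕ θ) ⊕ + 2 ⊛ r ⊖ n ⊖ 1ℤ ⊖ a) (+ 4 ⊛ θ ⊖ + 4) eq (identity p q z r a n θ)
  where
  identity : ∀ p q z r a n θ →
    p ⊛ + 8 ⊕ 1ℤ ⊕ (q ⊛ + 8 ⊕ 1ℤ ⊕ (+ 8 ⊛ z ⊕ (a ⊛ + 8 ⊕ + 4) ⊛ (r ⊛ + 4 ⊕ θ))) ⊖ (+ 8 ⊛ n ⊕ + 10 ⊕ (a ⊛ + 8 ⊕ + 4))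
    ≡ (p ⊕ q ⊕ z ⊕ a ⊛ (r ⊛ + 4 ⊕ θ) ⊕ + 2 ⊛ r ⊖ n ⊖ 1ℤ ⊖ a) ⊛ + 8 ⊕ (+ 4 ⊛ θ ⊖ + 4)
  identity = solve-∀

all-true : ∀ δ η θ → 4 ∣ ∣ bit δ ⊕ bit η ⊕ bit θ ⊖ + 3 ∣ → δ ≡ true × η ≡ true × θ ≡ true
all-true true  true  true  _ = refl , refl , refl
all-true true  true  false h = ⊥-elim (from-no (4 ∣? 1) h)
all-true true  false true  h = ⊥-elim (from-no (4 ∣? 1) h)
all-true true  false false h = ⊥-elim (from-no (4 ∣? 2) h)
all-true false true  true  h = ⊥-elim (from-no (4 ∣? 1) h)
all-true false true  false h = ⊥-elim (from-no (4 ∣? 2) h)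
all-true false false true  h = ⊥-elim (from-no (4 ∣? 2) h)
all-true false false false h = ⊥-elim (from-no (4 ∣? 3) h)

both-true : ∀ δ η → 4 ∣ ∣ bit δ ⊕ bit η ⊖ + 2 ∣ → δ ≡ true × η ≡ true
both-true true  true  _ = refl , refl
both-true true  false h = ⊥-elim (from-no (4 ∣? 1) h)
both-true false true  h = ⊥-elim (from-no (4 ∣? 1) h)
both-true false false h = ⊥-elim (from-no (4 ∣? 2) h)

one-true : ∀ θ → 8 ∣ ∣ + 4 ⊛ bit θ ⊖ + 4 ∣ → θ ≡ true
one-true true  _ = refl
one-true false h = ⊥-elim (from-no (8 ∣? 4) h)

balanced-odd : ∀ {m} → m ℕ.% 4 ≡ 1 ⊎ m ℕ.% 8 ≡ 4 → ∀ x y z w n →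
  Balanced (sq x) (sq y) (sq z) (sq w) (+ m) n → ¬ Even x × ¬ Even y × ¬ Even w
balanced-odd {m} residue x y z w n eq
  with p , δ , eqx , oddx ← square-mod-4 x | q , η , eqy , oddy ← square-mod-4 y | r , θ , eqw , oddw ← square-mod-4 w
  = [ case₁ , case₂ ]′ residue
  where
  division : ∀ d .{{_ : ℕ.NonZero d}} {c} → m ℕ.% d ≡ c → + m ≡ + (m ℕ./ d) ⊛ + d ⊕ + c
  division d {c} m%d = trans (cong +_ (trans (DM.m≡m%n+[m/n]*n m d) (trans (ℕₚ.+-comm (m ℕ.% d) _) (cong ((m ℕ./ d) ℕ.* d ℕ.+_) m%d))))
    (cong (_⊕ + c) (ℤₚ.pos-* (m ℕ./ d) d))

  rewritten : ∀ {X Y W M} → sq x ≡ X → sq y ≡ Y → sq w ≡ W → + m ≡ M → Balanced X Y (sq z) W M n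
  rewritten refl refl refl refl = eq

  case₁ : m ℕ.% 4 ≡ 1 → ¬ Even x × ¬ Even y × ¬ Even w
  case₁ m%4 = let δ≡ , η≡ , θ≡ = all-true δ η θ (balanced-1-mod-4 p q (sq z) r (+ (m ℕ./ 4)) n (bit δ) (bit η) (bit θ)
                                   (rewritten eqx eqy eqw (division 4 m%4)))
              in oddx δ≡ , oddy η≡ , oddw θ≡

  case₂ : m ℕ.% 8 ≡ 4 → ¬ Even x × ¬ Even y × ¬ Even w
  case₂ m%8 = ox , oy , oddw (one-true θ (balanced-4-mod-8′ (proj₁ x²) (proj₁ y²) (sq z) r (+ (m ℕ./ 8)) n (bit θ)
                                (rewritten (proj₂ x²) (proj₂ y²) eqw (division 8 m%8))))
    where
    δη = both-true δ η (balanced-4-mod-8 p q (sq z) (sq w) (+ (m ℕ./ 8)) n (bit δ) (bit η) (rewritten eqx eqy refl (division 8 m%8)))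
    ox = oddx (proj₁ δη)
    oy = oddy (proj₂ δη)
    x² = odd-square-mod-8 ox
    y² = odd-square-mod-8 oy

-- Counting in boxes

-- Nested pairs replace lists of fixed length so that `pairs` applies to them.
Tuple : ℕ → Set
Tuple zero    = ⊤
Tuple (suc k) = ℤ × Tuple k

toList : ∀ {k} → Tuple k → List ℤ
toList {zero}  _        = []
toList {suc k} (x , xs) = x ∷ toList xs

InCube : ∀ k → ℕ → Tuple k → Set
InCube zero    B _        = ⊤
InCube (suc k) B (x , xs) = ∣ x ∣ ℕ.≤ B × InCube k B xs

cube : ∀ k B → Enum (InCube k B)
cube zero    B = record { list = tt ∷ [] ; unique = [] ∷ [] ; sound = λ _ → tt ; complete = λ _ → here refl }
cube (suc k) B = pairs (interval B) (λ _ → cube k B)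

box-cube : ∀ k B → box k B ≡ map toList (list (cube k B))
box-cube zero    B = refl
box-cube (suc k) B = go (intRange B)
  where
  go : ∀ xs → concatMap (λ x → map (x ∷_) (box k B)) xs ≡ map toList (concatMap (λ x → map (x ,_) (list (cube k B))) xs)
  go []       = refl
  go (x ∷ xs) = begin
    map (x ∷_) (box k B) ++ concatMap (λ x → map (x ∷_) (box k B)) xs
      ≡⟨ cong₂ _++_ (trans (cong (map (x ∷_)) (box-cube k B)) (trans (sym (map-∘ (list (cube k B)))) (map-∘ (list (cube k B))))) (go xs) ⟩
    map toList (map (x ,_) (list (cube k B))) ++ map toList (concatMap (λ x → map (x ,_) (list (cube k B))) xs)
      ≡⟨ map-++ toList (map (x ,_) (list (cube k B))) _ ⟨
    map toList (map (x ,_) (list (cube k B)) ++ concatMap (λ x → map (x ,_) (list (cube k B))) xs)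
      ∎
    where open ≡-Reasoning

length-filter-map : {A B : Set} {P : B → Set} (P? : Decidable P) (f : A → B) (xs : List A) →
  length (filter P? (map f xs)) ≡ length (filter (P? ∘ f) xs)
length-filter-map P? f []       = refl
length-filter-map P? f (x ∷ xs) with P? (f x)
... | yes _ = cong suc (length-filter-map P? f xs)
... | no  _ = length-filter-map P? f xs

count-box : ∀ k B {P : List ℤ → Set} (P? : Decidable P) →
  + length (filter P? (box k B)) ≡ ∑ (restrict (cube k B) (P? ∘ toList)) (λ _ → 1ℤ)
count-box k B P? = trans
  (cong +_ (trans (cong (length ∘ filter P?) (box-cube k B)) (length-filter-map P? toList (list (cube k B)))))
  (length-as-sum (filter (P? ∘ toList) (list (cube k B))))

-- Both counts as sums over oddTriple

target : ℕ → ℕ → ℕ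
target m n = 8 ℕ.* n ℕ.+ 10 ℕ.+ suc m

target-expand : ∀ m n → + target m n ≡ + 8 ⊛ + n ⊕ + 10 ⊕ + suc m
target-expand m n = cong (λ c → c ⊕ + 10 ⊕ + suc m) (ℤₚ.pos-* 8 n)

qform-expand : ∀ m x y z w → qform (1 ∷ 1 ∷ 8 ∷ m ∷ []) (x ∷ y ∷ z ∷ w ∷ []) ≡ sq x ⊕ (sq y ⊕ (+ 8 ⊛ sq z ⊕ + m ⊛ sq w))
qform-expand m x y z w = identity (sq x) (sq y) (sq z) (sq w) (+ m)
  where
  identity : ∀ X Y Z W m → 1ℤ ⊛ X ⊕ (1ℤ ⊛ Y ⊕ (+ 8 ⊛ Z ⊕ (m ⊛ W ⊕ 0ℤ))) ≡ X ⊕ (Y ⊕ (+ 8 ⊛ Z ⊕ m ⊛ W))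
  identity = solve-∀

oddTriple-permute : ∀ m x y z w → + suc m ⊛ w ⊕ (x ⊕ (y ⊕ + 8 ⊛ z)) ≡ x ⊕ (y ⊕ (+ 8 ⊛ z ⊕ + suc m ⊛ w))
oddTriple-permute m x y z w = identity x y z (+ suc m ⊛ w)
  where
  identity : ∀ x y z w → w ⊕ (x ⊕ (y ⊕ + 8 ⊛ z)) ≡ x ⊕ (y ⊕ (+ 8 ⊛ z ⊕ w))
  identity = solve-∀

≤-head : ∀ {a b k} → 0ℤ ℤ.≤ b → a ⊕ b ℤ.≤ k → a ℤ.≤ k
≤-head {a} {b} b≥0 = ℤₚ.≤-trans (subst (ℤ._≤ a ⊕ b) (ℤₚ.+-identityʳ a) (ℤₚ.+-monoʳ-≤ a b≥0))

≤-tail : ∀ {a b k} → 0ℤ ℤ.≤ a → a ⊕ b ℤ.≤ k → b ℤ.≤ k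
≤-tail {a} {b} a≥0 = ℤₚ.≤-trans (subst (ℤ._≤ a ⊕ b) (ℤₚ.+-identityˡ b) (ℤₚ.+-monoˡ-≤ b a≥0))

-- All four terms are nonnegative, so each is at most k, and coercivity bounds its variable: the box
-- in `N` misses no solution.
solution-bound : ∀ m x y z w {k} → sq x ⊕ (sq y ⊕ (+ 8 ⊛ sq z ⊕ + suc m ⊛ sq w)) ≡ + k →
  InCube 4 k (x , y , z , w , tt)
solution-bound m x y z w eq =
  coercive-bound sq-coercive x (≤-head y+z+w≥0 b₁) ,
  coercive-bound sq-coercive y (≤-head z+w≥0 b₂) ,
  coercive-bound 8sq-coercive z (≤-head w≥0 b₃) ,
  coercive-bound (scale-coercive m sq-coercive) w (≤-tail z≥0 b₃) , tt
  where
  z≥0     = coercive-nonneg 8sq-coercive z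
  w≥0     = coercive-nonneg (scale-coercive m sq-coercive) w
  z+w≥0   = ℤₚ.+-mono-≤ z≥0 w≥0
  y+z+w≥0 = ℤₚ.+-mono-≤ (coercive-nonneg sq-coercive y) z+w≥0
  b₁ = ℤₚ.≤-reflexive eq
  b₂ = ≤-tail (coercive-nonneg sq-coercive x) b₁
  b₃ = ≤-tail (coercive-nonneg sq-coercive y) b₂

-- The congruences make X, Y and W odd in every solution, so passing to their indices is a
-- bijection. W is put first because it is the variable fixed first.
N-as-sum : ∀ m n → suc m ℕ.% 4 ≡ 1 ⊎ suc m ℕ.% 8 ≡ 4 →
  + N (1 ∷ 1 ∷ 8 ∷ suc m ∷ []) (target m n) ≡ ∑ (level (oddTriple m) (+ target m n)) (λ _ → 1ℤ)
N-as-sum m n residue = trans (count-box 4 k solves?)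
  (∑-reindex (restrict (cube 4 k) (solves? ∘ toList)) (level (oddTriple m) (+ k)) σ τ
    toOdd fromOdd τσ στ (λ _ → 1ℤ) (λ _ → 1ℤ) (λ _ _ → refl))
  where
  k = target m n
  Solves : List ℤ → Set
  Solves xs = qform (1 ∷ 1 ∷ 8 ∷ suc m ∷ []) xs ≡ + k
  solves? : Decidable Solves
  solves? xs = qform (1 ∷ 1 ∷ 8 ∷ suc m ∷ []) xs ℤ.≟ + k

  σ : Tuple 4 → ℤ × ℤ × ℤ × ℤ
  σ (x , y , z , w , _) = oddIndex w , oddIndex x , oddIndex y , z
  τ : ℤ × ℤ × ℤ × ℤ → Tuple 4
  τ (l , i , j , z) = odd i , odd j , z , odd l , tt

  parities : ∀ x y z w → Solves (x ∷ y ∷ z ∷ w ∷ []) → ¬ Even x × ¬ Even y × ¬ Even w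
  parities x y z w eq = balanced-odd residue x y z w (+ n)
    (trans (sym (qform-expand (suc m) x y z w)) (trans eq (target-expand m n)))

  τσ : ∀ v → InCube 4 k v × Solves (toList v) → τ (σ v) ≡ v
  τσ (x , y , z , w , _) (_ , eq) = let ox , oy , ow = parities x y z w eq in
    cong₂ _,_ (odd-oddIndex ox) (cong₂ _,_ (odd-oddIndex oy) (cong (λ c → z , c , tt) (odd-oddIndex ow)))

  στ : ∀ v → value (oddTriple m) v ≡ + k → σ (τ v) ≡ v
  στ (l , i , j , z) _ = cong₂ _,_ (oddIndex-odd l) (cong₂ _,_ (oddIndex-odd i) (cong (_, z) (oddIndex-odd j)))

  value-τ : ∀ v → value (oddTriple m) v ≡ qform (1 ∷ 1 ∷ 8 ∷ suc m ∷ []) (toList (τ v))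
  value-τ (l , i , j , z) = trans (oddTriple-permute m (odd² i) (odd² j) (sq z) (odd² l))
                                  (sym (qform-expand (suc m) (odd i) (odd j) z (odd l)))

  toOdd : ∀ v → InCube 4 k v × Solves (toList v) → value (oddTriple m) (σ v) ≡ + k
  toOdd v h@(_ , eq) = trans (value-τ (σ v)) (trans (cong (qform (1 ∷ 1 ∷ 8 ∷ suc m ∷ []) ∘ toList) (τσ v h)) eq)

  fromOdd : ∀ v → value (oddTriple m) v ≡ + k → InCube 4 k (τ v) × Solves (toList (τ v))
  fromOdd v@(l , i , j , z) eq =
    solution-bound m (odd i) (odd j) z (odd l) (trans (sym (oddTriple-permute m (odd² i) (odd² j) (sq z) (odd² l))) eq) ,
    trans (sym (value-τ v)) eq

-- The truncated division in `tri` is exact, as a product of consecutive integers is even and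
-- nonnegative.
tri-double : ∀ x → + (tri x ℕ.* 2) ≡ x ⊛ (x ⊖ 1ℤ)
tri-double x with t , eq ← consecutive-even x = begin
  + (tri x ℕ.* 2)          ≡⟨ cong (λ c → + (c ℕ./ 2 ℕ.* 2)) abs-product ⟩
  + (∣ t ∣ ℕ.* 2 ℕ./ 2 ℕ.* 2)  ≡⟨ cong (λ c → + (c ℕ.* 2)) (DM.m*n/n≡m ∣ t ∣ 2) ⟩
  + (∣ t ∣ ℕ.* 2)            ≡⟨ cong +_ abs-product ⟨
  + ∣ x ⊛ (x ⊖ 1ℤ) ∣         ≡⟨ product-nonneg x ⟩
  x ⊛ (x ⊖ 1ℤ)             ∎
  where
  open ≡-Reasoning
  abs-product : ∣ x ⊛ (x ⊖ 1ℤ) ∣ ≡ ∣ t ∣ ℕ.* 2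
  abs-product = trans (cong ∣_∣ eq) (ℤₚ.abs-* t (+ 2))
  product-nonneg : ∀ x → + ∣ x ⊛ (x ⊖ 1ℤ) ∣ ≡ x ⊛ (x ⊖ 1ℤ)
  product-nonneg (+ zero)  = refl
  product-nonneg (+ suc n) = subst (λ c → + ∣ c ∣ ≡ c) (ℤₚ.pos-* (suc n) n) refl
  product-nonneg -[1+ n ]  = refl

-- The odd number 2x - 1 of the substitution has index x - 1.
odd²-tri : ∀ x → odd² (x ⊖ 1ℤ) ≡ + 8 ⊛ + tri x ⊕ 1ℤ
odd²-tri x = begin
  odd² (x ⊖ 1ℤ)                    ≡⟨ expand x ⟩
  + 4 ⊛ (x ⊛ (x ⊖ 1ℤ)) ⊕ 1ℤ        ≡⟨ cong (λ c → + 4 ⊛ c ⊕ 1ℤ) (trans (sym (tri-double x)) (ℤₚ.pos-* (tri x) 2)) ⟩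
  + 4 ⊛ (+ tri x ⊛ + 2) ⊕ 1ℤ       ≡⟨ regroup (+ tri x) ⟩
  + 8 ⊛ + tri x ⊕ 1ℤ               ∎
  where
  open ≡-Reasoning
  expand : ∀ x → (+ 2 ⊛ (x ⊖ 1ℤ) ⊕ 1ℤ) ⊛ (+ 2 ⊛ (x ⊖ 1ℤ) ⊕ 1ℤ) ≡ + 4 ⊛ (x ⊛ (x ⊖ 1ℤ)) ⊕ 1ℤ
  expand = solve-∀
  regroup : ∀ t → + 4 ⊛ (t ⊛ + 2) ⊕ 1ℤ ≡ + 8 ⊛ t ⊕ 1ℤ
  regroup = solve-∀

-- Equality holds at x = 1 and x = 2, which explains the radius n + 1 of the box in `t`.
tri-bound : ∀ x → ∣ x ∣ ℕ.≤ suc (tri x)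
tri-bound (+ zero)        = ℕ.z≤n
tri-bound (+ suc zero)    = ℕ.s≤s ℕ.z≤n
tri-bound (+ suc (suc n)) = ℕ.s≤s (ℕₚ.*-cancelʳ-≤ (suc n) (tri (+ suc (suc n))) 2 (begin
  suc n ℕ.* 2                    ≤⟨ ℕₚ.*-monoʳ-≤ (suc n) (ℕ.s≤s (ℕ.s≤s (ℕ.z≤n {n}))) ⟩
  suc n ℕ.* suc (suc n)          ≡⟨ ℕₚ.*-comm (suc n) (suc (suc n)) ⟩
  suc (suc n) ℕ.* suc n          ≡⟨ ℤₚ.+-injective (trans (tri-double (+ suc (suc n))) (sym (ℤₚ.pos-* (suc (suc n)) (suc n)))) ⟨
  tri (+ suc (suc n)) ℕ.* 2      ∎))
  where open ℕₚ.≤-Reasoning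
tri-bound -[1+ n ] = ℕₚ.m≤n⇒m≤1+n (ℕₚ.*-cancelʳ-≤ (suc n) (tri -[1+ n ]) 2 (begin
  suc n ℕ.* 2                    ≤⟨ ℕₚ.*-monoʳ-≤ (suc n) (ℕ.s≤s (ℕ.s≤s (ℕ.z≤n {n}))) ⟩
  -- The sum n + 0 is what subtracting 1 from `-[1+ n ]` computes to.
  suc n ℕ.* suc (suc n)          ≡⟨ cong (λ c → suc n ℕ.* suc (suc c)) (ℕₚ.+-identityʳ n) ⟨
  suc n ℕ.* suc (suc (n ℕ.+ 0))  ≡⟨ ℤₚ.+-injective (tri-double -[1+ n ]) ⟨
  tri -[1+ n ] ℕ.* 2             ∎))
  where open ℕₚ.≤-Reasoning

tform-bound : ∀ m x y z w → let B = suc (tform (1 ∷ 1 ∷ 8 ∷ suc m ∷ []) (x ∷ y ∷ z ∷ w ∷ [])) in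
  InCube 4 B (x , y , z , w , tt)
tform-bound m x y z w =
  -- The first argument of `bound` is one less than the coefficient of the variable.
  bound 0 x (ℕₚ.m≤m+n a (b + (c + d))) ,
  bound 0 y (ℕₚ.m≤n⇒m≤o+n a (ℕₚ.m≤m+n b (c + d))) ,
  bound 7 z (ℕₚ.m≤n⇒m≤o+n a (ℕₚ.m≤n⇒m≤o+n b (ℕₚ.m≤m+n c d))) ,
  bound m w (ℕₚ.m≤n⇒m≤o+n a (ℕₚ.m≤n⇒m≤o+n b (ℕₚ.m≤n⇒m≤o+n c (ℕₚ.m≤m+n (suc m * tri w) 0)))) , tt
  where
  a = 1 * tri x
  b = 1 * tri y
  c = 8 * tri z
  d = suc m * tri w + 0
  bound : ∀ a x {s} → suc a ℕ.* tri x ℕ.≤ s → ∣ x ∣ ℕ.≤ suc s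
  bound a x le = ℕₚ.≤-trans (tri-bound x) (ℕ.s≤s (ℕₚ.≤-trans (ℕₚ.m≤n*m (tri x) (suc a)) le))

-- Completing the squares contributes 1 + 1 + 8 and the coefficient of W². Z enters as the odd
-- number itself, since `oddTriple` lets Z run over all integers.
oddTriple-tform : ∀ m x y z w →
  value (oddTriple m) (w ⊖ 1ℤ , x ⊖ 1ℤ , y ⊖ 1ℤ , odd (z ⊖ 1ℤ))
  ≡ + 8 ⊛ + tform (1 ∷ 1 ∷ 8 ∷ suc m ∷ []) (x ∷ y ∷ z ∷ w ∷ []) ⊕ + 10 ⊕ + suc m
oddTriple-tform m x y z w = begin
  + suc m ⊛ odd² (w ⊖ 1ℤ) ⊕ (odd² (x ⊖ 1ℤ) ⊕ (odd² (y ⊖ 1ℤ) ⊕ + 8 ⊛ odd² (z ⊖ 1ℤ)))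
    ≡⟨ cong₂ (λ W X → + suc m ⊛ W ⊕ (X ⊕ (odd² (y ⊖ 1ℤ) ⊕ + 8 ⊛ odd² (z ⊖ 1ℤ)))) (odd²-tri w) (odd²-tri x) ⟩
  + suc m ⊛ (+ 8 ⊛ + tri w ⊕ 1ℤ) ⊕ (+ 8 ⊛ + tri x ⊕ 1ℤ ⊕ (odd² (y ⊖ 1ℤ) ⊕ + 8 ⊛ odd² (z ⊖ 1ℤ)))
    ≡⟨ cong₂ (λ Y Z → + suc m ⊛ (+ 8 ⊛ + tri w ⊕ 1ℤ) ⊕ (+ 8 ⊛ + tri x ⊕ 1ℤ ⊕ (Y ⊕ + 8 ⊛ Z))) (odd²-tri y) (odd²-tri z) ⟩
  + suc m ⊛ (+ 8 ⊛ + tri w ⊕ 1ℤ) ⊕ (+ 8 ⊛ + tri x ⊕ 1ℤ ⊕ (+ 8 ⊛ + tri y ⊕ 1ℤ ⊕ + 8 ⊛ (+ 8 ⊛ + tri z ⊕ 1ℤ)))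
    ≡⟨ identity (+ suc m) (+ tri x) (+ tri y) (+ tri z) (+ tri w) ⟩
  + 8 ⊛ (1ℤ ⊛ + tri x ⊕ (1ℤ ⊛ + tri y ⊕ (+ 8 ⊛ + tri z ⊕ (+ suc m ⊛ + tri w ⊕ 0ℤ)))) ⊕ + 10 ⊕ + suc m
    ≡⟨ cong (λ s → + 8 ⊛ s ⊕ + 10 ⊕ + suc m) cast ⟨
  + 8 ⊛ + tform (1 ∷ 1 ∷ 8 ∷ suc m ∷ []) (x ∷ y ∷ z ∷ w ∷ []) ⊕ + 10 ⊕ + suc m ∎
  where
  open ≡-Reasoning
  identity : ∀ m x y z w →
    m ⊛ (+ 8 ⊛ w ⊕ 1ℤ) ⊕ (+ 8 ⊛ x ⊕ 1ℤ ⊕ (+ 8 ⊛ y ⊕ 1ℤ ⊕ + 8 ⊛ (+ 8 ⊛ z ⊕ 1ℤ)))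
    ≡ + 8 ⊛ (1ℤ ⊛ x ⊕ (1ℤ ⊛ y ⊕ (+ 8 ⊛ z ⊕ (m ⊛ w ⊕ 0ℤ)))) ⊕ + 10 ⊕ m
  identity = solve-∀
  cast : + tform (1 ∷ 1 ∷ 8 ∷ suc m ∷ []) (x ∷ y ∷ z ∷ w ∷ [])
    ≡ 1ℤ ⊛ + tri x ⊕ (1ℤ ⊛ + tri y ⊕ (+ 8 ⊛ + tri z ⊕ (+ suc m ⊛ + tri w ⊕ 0ℤ)))
  cast = cong₂ _⊕_ (ℤₚ.pos-* 1 (tri x)) (cong₂ _⊕_ (ℤₚ.pos-* 1 (tri y))
    (cong₂ _⊕_ (ℤₚ.pos-* 8 (tri z)) (cong (_⊕ 0ℤ) (ℤₚ.pos-* (suc m) (tri w)))))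

lastCoordinate : ℤ × ℤ × ℤ × ℤ → ℤ
lastCoordinate (_ , _ , _ , z) = z

-- Under X = 2x - 1 all four variables are odd. Three of these parities are built into `oddTriple`;
-- the restriction supplies that of Z.
t-as-sum : ∀ m n → + t (1 ∷ 1 ∷ 8 ∷ suc m ∷ []) n
  ≡ ∑ (restrict (level (oddTriple m) (+ target m n)) (¬? ∘ even? ∘ lastCoordinate)) (λ _ → 1ℤ)
t-as-sum m n = trans (count-box 4 (suc n) solves?)
  (∑-reindex (restrict (cube 4 (suc n)) (solves? ∘ toList))
    (restrict (level (oddTriple m) (+ target m n)) (¬? ∘ even? ∘ lastCoordinate)) σ τ
    toOdd fromOdd (λ v _ → τσ v) στ (λ _ → 1ℤ) (λ _ → 1ℤ) (λ _ _ → refl))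
  where
  Solves : List ℤ → Set
  Solves xs = tform (1 ∷ 1 ∷ 8 ∷ suc m ∷ []) xs ≡ n
  solves? : Decidable Solves
  solves? xs = tform (1 ∷ 1 ∷ 8 ∷ suc m ∷ []) xs ℕ.≟ n

  σ : Tuple 4 → ℤ × ℤ × ℤ × ℤ
  σ (x , y , z , w , _) = w ⊖ 1ℤ , x ⊖ 1ℤ , y ⊖ 1ℤ , odd (z ⊖ 1ℤ)
  τ : ℤ × ℤ × ℤ × ℤ → Tuple 4
  τ (l , i , j , z) = i ⊕ 1ℤ , j ⊕ 1ℤ , oddIndex z ⊕ 1ℤ , l ⊕ 1ℤ , tt

  cancel : ∀ x → x ⊖ 1ℤ ⊕ 1ℤ ≡ x
  cancel = solve-∀
  cancel′ : ∀ x → x ⊕ 1ℤ ⊖ 1ℤ ≡ x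
  cancel′ = solve-∀

  τσ : ∀ v → τ (σ v) ≡ v
  τσ (x , y , z , w , tt) = cong₂ _,_ (cancel x) (cong₂ _,_ (cancel y)
    (cong₂ _,_ (trans (cong (_⊕ 1ℤ) (oddIndex-odd (z ⊖ 1ℤ))) (cancel z)) (cong (_, tt) (cancel w))))

  στ : ∀ v → value (oddTriple m) v ≡ + target m n × ¬ Even (lastCoordinate v) → σ (τ v) ≡ v
  στ (l , i , j , z) (_ , oz) = cong₂ _,_ (cancel′ l) (cong₂ _,_ (cancel′ i)
    (cong₂ _,_ (cancel′ j) (trans (cong odd (cancel′ (oddIndex z))) (odd-oddIndex oz))))

  toOdd : ∀ v → InCube 4 (suc n) v × Solves (toList v) →
    value (oddTriple m) (σ v) ≡ + target m n × ¬ Even (lastCoordinate (σ v))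
  toOdd (x , y , z , w , _) (_ , eq) =
    trans (oddTriple-tform m x y z w) (trans (cong (λ s → + 8 ⊛ + s ⊕ + 10 ⊕ + suc m) eq) (sym (target-expand m n))) ,
    odd-odd (z ⊖ 1ℤ)

  fromOdd : ∀ v → value (oddTriple m) v ≡ + target m n × ¬ Even (lastCoordinate v) →
    InCube 4 (suc n) (τ v) × Solves (toList (τ v))
  fromOdd v@(l , i , j , z) h@(eq , _) =
    subst (λ B → InCube 4 (suc B) (τ v)) solves (tform-bound m (i ⊕ 1ℤ) (j ⊕ 1ℤ) (oddIndex z ⊕ 1ℤ) (l ⊕ 1ℤ)) , solves
    where
    s = tform (1 ∷ 1 ∷ 8 ∷ suc m ∷ []) (toList (τ v))
    balanced : + 8 ⊛ + s ⊕ + 10 ⊕ + suc m ≡ + 8 ⊛ + n ⊕ + 10 ⊕ + suc m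
    balanced = trans (sym (oddTriple-tform m (i ⊕ 1ℤ) (j ⊕ 1ℤ) (oddIndex z ⊕ 1ℤ) (l ⊕ 1ℤ)))
      (trans (cong (value (oddTriple m)) (στ v h)) (trans eq (target-expand m n)))
    drop : ∀ a b → a ⊕ + 10 ⊕ b ⊖ (+ 10 ⊕ b) ≡ a
    drop = solve-∀
    solves : s ≡ n
    solves = ℤₚ.+-injective (ℤₚ.*-cancelˡ-≡ (+ 8) (+ s) (+ n)
      (trans (sym (drop (+ 8 ⊛ + s) (+ suc m))) (trans (cong (_⊖ (+ 10 ⊕ + suc m)) balanced) (drop (+ 8 ⊛ + n) (+ suc m)))))

-- Equal numbers of representations with Z even and with Z odd

theorem2p3 : (m n : ℕ) → m > 0 → n > 0 →
    (m % 4 ≡ 1 ⊎ m % 8 ≡ 4) →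
    Σ ℕ (λ p → Prime p × p % 2 ≡ 1 × p ∣ m × legendre (+ (4 * n + 5)) p ≡ -[1+ 0 ]) →
    2 * t (1 ∷ 1 ∷ 8 ∷ m ∷ []) n ≡ N (1 ∷ 1 ∷ 8 ∷ m ∷ []) (8 * n + 10 + m)
theorem2p3 zero    n () _ _ _
-- At p = 0 the default value of `legendre` is 0, which differs from -1.
theorem2p3 (suc m) n _ _ residue (zero , _ , _ , _ , ())
theorem2p3 (suc m) n _ _ residue (suc p , _ , _ , divides c m≡cp , nonresidue) = ℤₚ.+-injective (begin
  + (2 * t (1 ∷ 1 ∷ 8 ∷ suc m ∷ []) n)            ≡⟨ ℤₚ.pos-* 2 (t (1 ∷ 1 ∷ 8 ∷ suc m ∷ []) n) ⟩
  + 2 ⊛ + t (1 ∷ 1 ∷ 8 ∷ suc m ∷ []) n            ≡⟨ cong (+ 2 ⊛_) (t-as-sum m n) ⟩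
  + 2 ⊛ #odd                                      ≡⟨ twice #odd ⟩
  #odd ⊕ #odd                                     ≡⟨ cong (_⊕ #odd) #even≡#odd ⟨
  #even ⊕ #odd                                    ≡⟨ ∑-split E (even? ∘ lastCoordinate) (λ _ → 1ℤ) ⟨
  ∑ E (λ _ → 1ℤ)                                  ≡⟨ N-as-sum m n residue ⟨
  + N (1 ∷ 1 ∷ 8 ∷ suc m ∷ []) (8 * n + 10 + suc m)  ∎)
  where
  open ≡-Reasoning
  E  = level (oddTriple m) (+ target m n)
  E⁺ = restrict E (even? ∘ lastCoordinate)
  E⁻ = restrict E (¬? ∘ even? ∘ lastCoordinate)
  #even = ∑ E⁺ (λ _ → 1ℤ)
  #odd  = ∑ E⁻ (λ _ → 1ℤ)

  twice : ∀ x → + 2 ⊛ x ≡ x ⊕ x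
  twice = solve-∀

  nonsquare : ∀ l i → odd² i ≢ + (4 * n + 5) ⊖ + suc m ⊛ (+ 2 ⊛ (l ⊛ l ⊕ l))
  -- As m is c times p, the subtracted term is p times the witness given here, so an odd square of
  -- this form would be a square congruent to 4n + 5 modulo p.
  nonsquare l i eq = nonresidue-nonsquare (4 * n + 5) p nonresidue (odd i) (+ c ⊛ (+ 2 ⊛ (l ⊛ l ⊕ l))) (trans eq
    (cong (+ (4 * n + 5) ⊖_) (trans (cong (_⊛ (+ 2 ⊛ (l ⊛ l ⊕ l))) (trans (cong +_ m≡cp) (ℤₚ.pos-* c (suc p))))
      (regroup (+ c) (+ suc p) (+ 2 ⊛ (l ⊛ l ⊕ l))))))
    where
    regroup : ∀ c p y → c ⊛ p ⊛ y ≡ p ⊛ (c ⊛ y)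
    regroup = solve-∀

  s : ℤ × ℤ × ℤ × ℤ → ℤ
  s = sgn ∘ lastCoordinate

  E⁺-signs : ∑ E⁺ s ≡ #even
  E⁺-signs = ∑-cong E⁺ (λ v (_ , ev) → trans (cong sgn ev) (sgn-double (half (lastCoordinate v))))

  E⁻-signs : ∑ E⁻ s ≡ -1ℤ ⊛ #odd
  E⁻-signs = trans (∑-cong E⁻ {g = λ _ → -1ℤ ⊛ 1ℤ} (λ v (_ , oz) → trans (cong sgn (proj₂ (not-even oz))) (sgn-odd (proj₁ (not-even oz)))))
                   (∑-* E⁻ -1ℤ (λ _ → 1ℤ))

  #even≡#odd : #even ≡ #odd
  -- The difference of the two counts is the sum of (-1)^Z over all representations.
  #even≡#odd = ℤₚ.i-j≡0⇒i≡j #even #odd (begin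
    #even ⊖ #odd          ≡⟨ cong (#even ⊕_) (ℤₚ.-1*i≡-i #odd) ⟨
    #even ⊕ -1ℤ ⊛ #odd    ≡⟨ cong₂ _⊕_ E⁺-signs E⁻-signs ⟨
    ∑ E⁺ s ⊕ ∑ E⁻ s       ≡⟨ ∑-split E (even? ∘ lastCoordinate) s ⟨
    ∑ E s                 ≡⟨ ∑-oddTriple m n nonsquare ⟩
    0ℤ                    ∎)
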